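{- Let $n\ge2$ be an integer with distinct prime divisors $p_1,\dots,p_k$. Let $a,a'$ be squarefree integers with $a\equiv a'\pmod{np_1\cdots p_k}$, and let $\theta,\theta'$ be roots of $x^n-a$ and $x^n-a'$ respectively such that $K=\mathbb{Q}(\theta)$ and $K'=\mathbb{Q}(\theta')$ both have degree $n$ over $\mathbb{Q}$. Then for all integers $c_0,\dots,c_{n-1}$ and nonzero integers $q$, the element $\frac1q(c_0+c_1\theta+\cdots+c_{n-1}\theta^{n-1})$ lies in $A_K$ if and only if $\frac1q(c_0+c_1\theta'+\cdots+c_{n-1}\theta'^{\,n-1})$ lies in $A_{K'}$.
   Context: $A_K$ denotes the ring of algebraic integers of the number field $K$. -}

module Defs where

open import Data.Nat as ℕ using (ℕ; zero; suc)
import Data.Nat.Divisibility as ℕD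
open import Data.Nat.Primality using (Prime; prime?)
open import Data.Integer as ℤ using (ℤ; +_; -[1+_])
import Data.Integer.Divisibility as ℤD
open import Data.Rational as ℚ using (ℚ; 0ℚ; 1ℚ)
open import Data.List as List using (List; []; _∷_; upTo; filter; replicate; _++_; length)
open import Data.Nat.ListAction using (product)
open import Data.Vec as Vec using (Vec; []; _∷_; init; last; zipWith; toList)
open import Data.Product using (Σ; ∃; _×_)
open import Relation.Nullary using (¬_)
open import Relation.Nullary.Decidable using (_×-dec_)
open import Relation.Binary.PropositionalEquality using (_≡_)

-- a squarefree integer: no square of a natural number d ≠ 1 divides a
-- (in particular 0 is not squarefree, since 0*0 ∣ 0).
SquareFree : ℤ → Set
SquareFree a = ∀ (d : ℕ) → (d ℕ.* d) ℕD.∣ ℤ.∣ a ∣ → d ≡ 1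

rad : ℕ → ℕ
rad n = product (filter (λ p → prime? p ×-dec (p ℕD.∣? n)) (upTo (suc n)))

_≡_[mod_] : ℤ → ℤ → ℕ → Set
a ≡ a' [mod m ] = (+ m) ℤD.∣ (a ℤ.- a')

-- Rational polynomials as coefficient lists (constant term first)

padd : List ℚ → List ℚ → List ℚ
padd [] g = g
padd (x ∷ f) [] = x ∷ f
padd (x ∷ f) (y ∷ g) = (x ℚ.+ y) ∷ padd f g

pmul : List ℚ → List ℚ → List ℚ
pmul [] g = []
pmul (c ∷ f) g = padd (List.map (c ℚ.*_) g) (0ℚ ∷ pmul f g)

-- coefficient list of x^n - a  (for n ≥ 1)
xⁿ-a : ℕ → ℤ → List ℚ
xⁿ-a n a = (ℚ.- (a ℚ./ 1)) ∷ (replicate (n ℕ.∸ 1) 0ℚ ++ (1ℚ ∷ []))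

-- x^n - a is irreducible over ℚ: it is not a product of two rational
-- polynomials each of degree ≥ 1 (lists of length ≥ 2; comparing with the
-- exact coefficient list of x^n - a forces the leading coefficients to be
-- nonzero, so the lengths are degrees + 1).
IrreducibleXⁿ-a : ℕ → ℤ → Set
IrreducibleXⁿ-a n a =
  ¬ (Σ (List ℚ) λ f → Σ (List ℚ) λ g →
       (2 ℕ.≤ length f) × (2 ℕ.≤ length g) × (pmul f g ≡ xⁿ-a n a))

-- The field K = ℚ(θ), θⁿ = a, realised as ℚ[x]/(xⁿ - a):
-- an element is its coordinate vector w.r.t. the basis 1, θ, …, θ^{n-1}.

one′ : (n : ℕ) → Vec ℚ n
one′ zero = []
one′ (suc m) = 1ℚ ∷ Vec.replicate m 0ℚ

-- multiplication by θ on coordinate vectors, using θⁿ = a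
mulθ′ : {n : ℕ} → ℤ → Vec ℚ n → Vec ℚ n
mulθ′ {zero} a v = v
mulθ′ {suc m} a v = ((a ℚ./ 1) ℚ.* last v) ∷ init v

module _ (n : ℕ) (a : ℤ) where

  Elt : Set
  Elt = Vec ℚ n

  zeroK : Elt
  zeroK = Vec.replicate n 0ℚ

  oneK : Elt
  oneK = one′ n

  addK : Elt → Elt → Elt
  addK = zipWith ℚ._+_

  scaleK : ℚ → Elt → Elt
  scaleK c = Vec.map (c ℚ.*_)

  mulθ : Elt → Elt
  mulθ = mulθ′ a

  mulL : List ℚ → Elt → Elt
  mulL [] v = zeroK
  mulL (c ∷ cs) v = addK (scaleK c v) (mulθ (mulL cs v))

  mulK : Elt → Elt → Elt
  mulK u v = mulL (toList u) v

  -- value at v of the monic integer polynomial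
  --   x^m + b_{m-1} x^{m-1} + … + b₀   where bs = b₀ ∷ … ∷ b_{m-1}
  monicEval : List ℤ → Elt → Elt
  monicEval [] v = oneK
  monicEval (b ∷ bs) v = addK (scaleK (b ℚ./ 1) oneK) (mulK v (monicEval bs v))

  IsAlgInt : Elt → Set
  IsAlgInt v = Σ (List ℤ) λ bs → monicEval bs v ≡ zeroK

-- c / q for integers c and q ≠ 0 (value for q = 0 is irrelevant)
_÷ℤ_ : ℤ → ℤ → ℚ
c ÷ℤ (+ zero) = 0ℚ
c ÷ℤ (+ (suc k)) = c ℚ./ suc k
c ÷ℤ (-[1+ k ]) = (ℤ.- c) ℚ./ suc k

eltOf : {n : ℕ} → Vec ℤ n → ℤ → Vec ℚ n
eltOf c q = Vec.map (λ cᵢ → cᵢ ÷ℤ q) c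

{-# OPTIONS --safe #-}
module Submission where

-- Call an element of a number field bounded if its powers have a common denominator. As ℤⁿ is
-- Noetherian this is the same as being integral, and bounded elements visibly form a ring.
-- Write a′ = a + n r t with r = rad n, and let xⁿ = a and yⁿ = a′ in ℚ(θ) ⊗ ℚ(θ′). The element
-- z = (yⁿ - xⁿ) / (n (y - x)) satisfies z (y - x) = r t, which turns the binomial expansion of
-- n z in powers of y - x into a monic equation for z with coefficients built from the integers
-- C(n,i+1) rⁱ / n; so z is integral. By Lagrange interpolation a f(θ′) is the trace of f(x) x z,
-- so it is integral when f(θ) is. The trace is computed one prime factor p of n at a time, as a
-- sum of conjugates under x ↦ wᵏ x with wᵖ = 1. Finally xⁿ - a is Eisenstein at every prime
-- dividing the squarefree a, so f has a denominator q prime to a; since both q f(θ′) and a f(θ′)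
-- are integral, so is f(θ′).

open import Defs
open import Algebra.Bundles using (CommutativeRing)
import Algebra.Properties.CommutativeSemiring.Exp as Exp
import Algebra.Properties.Ring as RingP
import Algebra.Solver.Ring.NaturalCoefficients.Default as Solver
open import Algebra.Structures using (IsCommutativeRing)
open import Data.Empty using (⊥; ⊥-elim)
open import Data.Integer as ℤ using (ℤ; +_; -[1+_])
import Data.Integer.DivMod as ℤDM
import Data.Integer.Divisibility.Signed as ℤDS
import Data.Integer.Properties as ℤP
open import Data.List as List using (List; []; _∷_; length)
open import Data.List.Membership.Propositional.Properties using (∈-filter⁺; ∈-upTo⁺)
import Data.List.Properties as ListP
import Data.List.Relation.Unary.All as ListAll
open import Data.Nat as ℕ using (ℕ; zero; suc; _≤_; _<_; s≤s; z≤n)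
open import Data.Nat.Combinatorics using (_C_; nCk+nC[k+1]≡[n+1]C[k+1]; k>n⇒nCk≡0)
open import Data.Nat.Coprimality as Coprimality using (Coprime; coprime-Bézout; coprime-divisor; gcd≡1⇒coprime)
open import Data.Nat.Divisibility as ∣ using (_∣_; divides)
open import Data.Nat.GCD using (gcd; gcd[m,n]∣m; gcd[m,n]∣n; gcd[m,n]≡0⇒m≡0; module Bézout)
open import Data.Nat.Induction using (Acc; acc; <-wellFounded)
open import Data.Nat.ListAction using (product)
open import Data.Nat.ListAction.Properties using (∈⇒∣product)
open import Data.Nat.Primality
  using (Prime; prime?; prime⇒nonZero; prime⇒nonTrivial; productOfPrimes≥1; euclidsLemma; ¬prime[0]; ¬prime[1])
open import Data.Nat.Primality.Factorisation using (factorise; PrimeFactorisation)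
import Data.Nat.Properties as ℕP
open import Data.Nat.Solver using (module +-*-Solver)
open import Data.Product using (Σ; _,_; proj₁; proj₂; _×_)
open import Data.Rational as ℚ using (ℚ; 0ℚ; 1ℚ)
import Data.Rational.Properties as ℚP
import Data.Rational.Unnormalised as ℚᵘ
import Data.Rational.Unnormalised.Properties as ℚᵘP
open import Data.Sum using (inj₁; inj₂)
open import Data.Vec as Vec using (Vec; []; _∷_; map; zipWith; replicate; take; drop)
open import Data.Vec.Properties
  using (zipWith-assoc; zipWith-comm; zipWith-identityˡ; zipWith-identityʳ; zipWith-inverseˡ; zipWith-inverseʳ
        ; ∷-injective; take++drop≡id)
open import Data.Vec.Relation.Unary.All using (All; []; _∷_)
import Data.Vec.Relation.Unary.All.Properties as AllP
open import Level using (0ℓ)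
open import Relation.Binary.PropositionalEquality
open import Relation.Nullary using (yes; no; ¬_)
open import Relation.Nullary.Decidable using (_×-dec_; ¬?; decidable-stable)
open ≡-Reasoning

-- The ring ℚ(θ) ⊗ ℚ(θ′) can have zero divisors, and neither y - x nor 1 - w has to be invertible.
-- The arguments therefore work with coordinate vectors over commutative ℚ-algebras and divide by
-- nonzero integers only; boundedness passes along homomorphisms and is read off from coordinates.
-- The modulus n r has two tasks. Its factor n absorbs the denominator n of z, leaving z y = z x + r
-- t. Its factor r pays for the denominators of C(n,i+1) / n = C(n-1,i) / (i+1): a prime divisor of
-- n occurs in i + 1 at most i times, so that rⁱ suffices. Conjugates are handled one prime p at a
-- time because, once wᵖ = 1 and p ∤ i, the powers of wⁱ are the powers of w. The geometric sum of
-- wⁱ is then fixed by w, so 1 - w kills every coefficient in a degree not divisible by p.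

opaque
  fromℤ : ℤ → ℚ
  fromℤ c = c ℚ./ 1

  fromℤ-/1 : ∀ c → fromℤ c ≡ c ℚ./ 1
  fromℤ-/1 c = refl

-- Commutative ℚ-algebras with a subring of integers

-- A commutative ℚ-algebra with a subring Int, which in a number field ℚ(θ) will be ℤ[θ].
record Algebra : Set₁ where
  infixl 6 _+_
  infixl 7 _*_
  infix 8 -_
  field
    Carrier : Set
    _+_ _*_ : Carrier → Carrier → Carrier
    -_ : Carrier → Carrier
    0# 1# : Carrier
    isCommutativeRing : IsCommutativeRing _≡_ _+_ _*_ -_ 0# 1#
    ι : ℚ → Carrier
    ι-+ : ∀ p q → ι (p ℚ.+ q) ≡ ι p + ι q
    ι-* : ∀ p q → ι (p ℚ.* q) ≡ ι p * ι q
    ι-1 : ι 1ℚ ≡ 1#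
    Int : Carrier → Set
    Int-+ : ∀ {x y} → Int x → Int y → Int (x + y)
    Int-* : ∀ {x y} → Int x → Int y → Int (x * y)
    Int-ι : ∀ c → Int (ι (fromℤ c))

  commutativeRing : CommutativeRing 0ℓ 0ℓ
  commutativeRing = record { isCommutativeRing = isCommutativeRing }
  open CommutativeRing commutativeRing public
    using (+-assoc; +-comm; +-identityˡ; +-identityʳ; -‿inverseˡ; -‿inverseʳ
          ; *-assoc; *-comm; *-identityˡ; *-identityʳ; distribˡ; distribʳ; zeroˡ; zeroʳ; commutativeSemiring; ring)
  open Exp commutativeSemiring public using (_^_; ^-homo-*; ^-assocʳ; ^-distrib-*)

  open RingP ring public using (+-cancelʳ; -‿distribˡ-*; -1*x≈-x; -0#≈0#)

  ι-0 : ι 0ℚ ≡ 0#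
  ι-0 = +-cancelʳ (ι 0ℚ) (ι 0ℚ) 0# (trans (sym (ι-+ 0ℚ 0ℚ)) (sym (+-identityˡ _)))

  Int-0 : Int 0#
  Int-0 = subst Int (trans (cong ι (fromℤ-/1 (+ 0))) ι-0) (Int-ι (+ 0))

  Int-1 : Int 1#
  Int-1 = subst Int (trans (cong ι (fromℤ-/1 (+ 1))) ι-1) (Int-ι (+ 1))

  Int--1 : Int (- 1#)
  Int--1 = subst Int ι--1 (Int-ι ℤ.-1ℤ)
    where
    ι--1 : ι (fromℤ ℤ.-1ℤ) ≡ - 1#
    ι--1 = +-cancelʳ 1# _ _ (trans (cong₂ _+_ (cong ι (fromℤ-/1 ℤ.-1ℤ)) (sym ι-1))
      (trans (sym (ι-+ (ℚ.- 1ℚ) 1ℚ)) (trans ι-0 (sym (-‿inverseˡ 1#)))))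

  open Solver commutativeSemiring public using (solve; _:=_; _:+_; _:*_; con)

-- The quotient ring R[x]/(xⁿ - α)

-- R[x]/(xⁿ - α) on coordinate vectors with respect to 1, x, …, xⁿ⁻¹.
module Quotient (R : Algebra) where
  open Algebra R

  private variable k l : ℕ

  infixl 6 _⊕_
  infixr 7 _•_

  _⊕_ : Vec Carrier k → Vec Carrier k → Vec Carrier k
  _⊕_ = zipWith _+_

  _•_ : Carrier → Vec Carrier k → Vec Carrier k
  c • v = map (c *_) v

  0̂ : Vec Carrier k
  0̂ = replicate _ 0#

  -- `push c v` and `lastOr c v` cut `c ∷ v` into its first k entries and its last one. In this form
  -- multiplication by x needs no case distinction on whether k is zero.
  push : Carrier → Vec Carrier k → Vec Carrier k
  push c [] = []
  push c (x ∷ v) = c ∷ push x v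

  lastOr : Carrier → Vec Carrier k → Carrier
  lastOr c [] = c
  lastOr c (x ∷ v) = lastOr x v

  basis : ℕ → Vec Carrier k
  basis {zero} _ = []
  basis {suc k} zero = 1# ∷ 0̂
  basis {suc k} (suc j) = 0# ∷ basis j

  push-⊕ : ∀ c d (u v : Vec Carrier k) → push (c + d) (u ⊕ v) ≡ push c u ⊕ push d v
  push-⊕ c d [] [] = refl
  push-⊕ c d (x ∷ u) (y ∷ v) = cong (c + d ∷_) (push-⊕ x y u v)

  push-• : ∀ a c (v : Vec Carrier k) → push (a * c) (a • v) ≡ a • push c v
  push-• a c [] = refl
  push-• a c (x ∷ v) = cong (a * c ∷_) (push-• a x v)

  lastOr-⊕ : ∀ c d (u v : Vec Carrier k) → lastOr (c + d) (u ⊕ v) ≡ lastOr c u + lastOr d v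
  lastOr-⊕ c d [] [] = refl
  lastOr-⊕ c d (x ∷ u) (y ∷ v) = lastOr-⊕ x y u v

  lastOr-• : ∀ a c (v : Vec Carrier k) → lastOr (a * c) (a • v) ≡ a * lastOr c v
  lastOr-• a c [] = refl
  lastOr-• a c (x ∷ v) = lastOr-• a x v

  ⊕-assoc : ∀ (u v w : Vec Carrier k) → (u ⊕ v) ⊕ w ≡ u ⊕ (v ⊕ w)
  ⊕-assoc = zipWith-assoc +-assoc

  ⊕-comm : ∀ (u v : Vec Carrier k) → u ⊕ v ≡ v ⊕ u
  ⊕-comm = zipWith-comm +-comm

  ⊕-identityˡ : ∀ (u : Vec Carrier k) → 0̂ ⊕ u ≡ u
  ⊕-identityˡ = zipWith-identityˡ +-identityˡ

  ⊕-identityʳ : ∀ (u : Vec Carrier k) → u ⊕ 0̂ ≡ u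
  ⊕-identityʳ = zipWith-identityʳ +-identityʳ

  ⊕-interchange : ∀ (u v w x : Vec Carrier k) → (u ⊕ v) ⊕ (w ⊕ x) ≡ (u ⊕ w) ⊕ (v ⊕ x)
  ⊕-interchange [] [] [] [] = refl
  ⊕-interchange (u ∷ us) (v ∷ vs) (w ∷ ws) (x ∷ xs) = cong₂ _∷_
    (solve 4 (λ u v w x → (u :+ v) :+ (w :+ x) := (u :+ w) :+ (v :+ x)) refl u v w x)
    (⊕-interchange us vs ws xs)

  •-⊕ : ∀ a (u v : Vec Carrier k) → a • (u ⊕ v) ≡ a • u ⊕ a • v
  •-⊕ a [] [] = refl
  •-⊕ a (x ∷ u) (y ∷ v) = cong₂ _∷_ (distribˡ a x y) (•-⊕ a u v)

  +-• : ∀ a b (v : Vec Carrier k) → (a + b) • v ≡ a • v ⊕ b • v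
  +-• a b [] = refl
  +-• a b (x ∷ v) = cong₂ _∷_ (distribʳ x a b) (+-• a b v)

  *-• : ∀ a b (v : Vec Carrier k) → (a * b) • v ≡ a • (b • v)
  *-• a b [] = refl
  *-• a b (x ∷ v) = cong₂ _∷_ (*-assoc a b x) (*-• a b v)

  1-• : ∀ (v : Vec Carrier k) → 1# • v ≡ v
  1-• [] = refl
  1-• (x ∷ v) = cong₂ _∷_ (*-identityˡ x) (1-• v)

  0-• : ∀ (v : Vec Carrier k) → 0# • v ≡ 0̂
  0-• [] = refl
  0-• (x ∷ v) = cong₂ _∷_ (zeroˡ x) (0-• v)

  •-0 : ∀ a → a • 0̂ {k} ≡ 0̂
  •-0 {zero} a = refl
  •-0 {suc k} a = cong₂ _∷_ (zeroʳ a) (•-0 a)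

  •-comm : ∀ a b (v : Vec Carrier k) → a • (b • v) ≡ b • (a • v)
  •-comm a b v = trans (sym (*-• a b v)) (trans (cong (_• v) (*-comm a b)) (*-• b a v))

  push-0 : push 0# (0̂ {k}) ≡ 0̂
  push-0 {zero} = refl
  push-0 {suc k} = cong (0# ∷_) push-0

  lastOr-0 : lastOr 0# (0̂ {k}) ≡ 0#
  lastOr-0 {zero} = refl
  lastOr-0 {suc k} = lastOr-0 {k}

  push-1-0̂ : push 1# (0̂ {k}) ≡ basis 0
  push-1-0̂ {zero} = refl
  push-1-0̂ {suc k} = cong (1# ∷_) push-0

  push-basis : ∀ j → push 0# (basis {k} j) ≡ basis (suc j)
  push-basis {zero} j = refl
  push-basis {suc k} zero = cong (0# ∷_) push-1-0̂
  push-basis {suc k} (suc j) = cong (0# ∷_) (push-basis j)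

  lastOr-basis-< : ∀ {c} j → suc j ℕ.< k → lastOr c (basis {k} j) ≡ 0#
  lastOr-basis-< {suc zero} j (ℕ.s≤s ())
  lastOr-basis-< {suc (suc k)} zero _ = lastOr-0 {k}
  lastOr-basis-< {suc (suc k)} (suc j) (ℕ.s≤s p) = lastOr-basis-< j p

  lastOr-basis : ∀ c k → lastOr c (basis {suc k} k) ≡ 1#
  lastOr-basis c zero = refl
  lastOr-basis c (suc k) = lastOr-basis 0# k

  basis-overflow : ∀ k → basis {k} k ≡ 0̂
  basis-overflow zero = refl
  basis-overflow (suc k) = cong (0# ∷_) (basis-overflow k)

  module _ (n : ℕ) (α : Carrier) where

    V : Set
    V = Vec Carrier n

    θ : V → V
    θ v = push (α * lastOr 0# v) v

    -- Horner's scheme for a polynomial in the operator `θ`. The number k of coefficients is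
    -- independent of n, which allows induction on the polynomial.
    act : Vec Carrier k → V → V
    act [] v = 0̂
    act (c ∷ cs) v = c • v ⊕ θ (act cs v)

    one : V
    one = basis 0

    θ-⊕ : ∀ u v → θ (u ⊕ v) ≡ θ u ⊕ θ v
    θ-⊕ u v = begin
      push (α * lastOr 0# (u ⊕ v)) (u ⊕ v)
        ≡⟨ cong (λ z → push (α * lastOr z (u ⊕ v)) (u ⊕ v)) (sym (+-identityˡ 0#)) ⟩
      push (α * lastOr (0# + 0#) (u ⊕ v)) (u ⊕ v)
        ≡⟨ cong (λ z → push (α * z) (u ⊕ v)) (lastOr-⊕ 0# 0# u v) ⟩
      push (α * (lastOr 0# u + lastOr 0# v)) (u ⊕ v)
        ≡⟨ cong (λ z → push z (u ⊕ v)) (distribˡ α _ _) ⟩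
      push (α * lastOr 0# u + α * lastOr 0# v) (u ⊕ v)
        ≡⟨ push-⊕ _ _ u v ⟩
      θ u ⊕ θ v ∎

    θ-• : ∀ a v → θ (a • v) ≡ a • θ v
    θ-• a v = begin
      push (α * lastOr 0# (a • v)) (a • v)
        ≡⟨ cong (λ z → push (α * lastOr z (a • v)) (a • v)) (sym (zeroʳ a)) ⟩
      push (α * lastOr (a * 0#) (a • v)) (a • v)
        ≡⟨ cong (λ z → push (α * z) (a • v)) (lastOr-• a 0# v) ⟩
      push (α * (a * lastOr 0# v)) (a • v)
        ≡⟨ cong (λ z → push z (a • v)) (solve 3 (λ x y z → x :* (y :* z) := y :* (x :* z)) refl α a _) ⟩
      push (a * (α * lastOr 0# v)) (a • v)
        ≡⟨ push-• a _ v ⟩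
      a • θ v ∎

    θ-0 : θ 0̂ ≡ 0̂
    θ-0 = trans (cong (λ z → push (α * z) 0̂) (lastOr-0 {n})) (trans (cong (λ z → push z 0̂) (zeroʳ α)) push-0)

    act-⊕ʳ : ∀ (cs : Vec Carrier k) u v → act cs (u ⊕ v) ≡ act cs u ⊕ act cs v
    act-⊕ʳ [] u v = sym (⊕-identityˡ 0̂)
    act-⊕ʳ (c ∷ cs) u v = begin
      c • (u ⊕ v) ⊕ θ (act cs (u ⊕ v))
        ≡⟨ cong₂ _⊕_ (•-⊕ c u v) (trans (cong θ (act-⊕ʳ cs u v)) (θ-⊕ _ _)) ⟩
      (c • u ⊕ c • v) ⊕ (θ (act cs u) ⊕ θ (act cs v))
        ≡⟨ ⊕-interchange _ _ _ _ ⟩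
      act (c ∷ cs) u ⊕ act (c ∷ cs) v ∎

    act-⊕ˡ : ∀ (cs ds : Vec Carrier k) v → act (cs ⊕ ds) v ≡ act cs v ⊕ act ds v
    act-⊕ˡ [] [] v = sym (⊕-identityˡ 0̂)
    act-⊕ˡ (c ∷ cs) (d ∷ ds) v = begin
      (c + d) • v ⊕ θ (act (cs ⊕ ds) v)
        ≡⟨ cong₂ _⊕_ (+-• c d v) (trans (cong θ (act-⊕ˡ cs ds v)) (θ-⊕ _ _)) ⟩
      (c • v ⊕ d • v) ⊕ (θ (act cs v) ⊕ θ (act ds v))
        ≡⟨ ⊕-interchange _ _ _ _ ⟩
      act (c ∷ cs) v ⊕ act (d ∷ ds) v ∎

    act-•ʳ : ∀ (cs : Vec Carrier k) a v → act cs (a • v) ≡ a • act cs v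
    act-•ʳ [] a v = sym (•-0 a)
    act-•ʳ (c ∷ cs) a v = trans
      (cong₂ _⊕_ (•-comm c a v) (trans (cong θ (act-•ʳ cs a v)) (θ-• a _)))
      (sym (•-⊕ a _ _))

    act-•ˡ : ∀ a (cs : Vec Carrier k) v → act (a • cs) v ≡ a • act cs v
    act-•ˡ a [] v = sym (•-0 a)
    act-•ˡ a (c ∷ cs) v = trans
      (cong₂ _⊕_ (*-• a c v) (trans (cong θ (act-•ˡ a cs v)) (θ-• a _)))
      (sym (•-⊕ a _ _))

    act-θ : ∀ (cs : Vec Carrier k) v → act cs (θ v) ≡ θ (act cs v)
    act-θ [] v = sym θ-0
    act-θ (c ∷ cs) v = trans
      (cong₂ _⊕_ (sym (θ-• c v)) (cong θ (act-θ cs v)))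
      (sym (θ-⊕ _ _))

    act-0 : ∀ (cs : Vec Carrier k) → act cs 0̂ ≡ 0̂
    act-0 [] = refl
    act-0 (c ∷ cs) = trans (cong₂ _⊕_ (•-0 c) (trans (cong θ (act-0 cs)) θ-0)) (⊕-identityˡ 0̂)

    act-comm : ∀ (cs : Vec Carrier k) (ds : Vec Carrier l) v → act cs (act ds v) ≡ act ds (act cs v)
    act-comm [] ds v = sym (act-0 ds)
    act-comm (c ∷ cs) ds v = begin
      c • act ds v ⊕ θ (act cs (act ds v))
        ≡⟨ cong₂ _⊕_ (sym (act-•ʳ ds c v)) (trans (cong θ (act-comm cs ds v)) (sym (act-θ ds _))) ⟩
      act ds (c • v) ⊕ act ds (θ (act cs v))
        ≡⟨ sym (act-⊕ʳ ds _ _) ⟩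
      act ds (act (c ∷ cs) v) ∎

    θ^ : ℕ → V → V
    θ^ zero v = v
    θ^ (suc j) v = θ (θ^ j v)

    act-θ^ : ∀ j (cs : Vec Carrier k) v → act cs (θ^ j v) ≡ θ^ j (act cs v)
    act-θ^ zero cs v = refl
    act-θ^ (suc j) cs v = trans (act-θ cs _) (cong θ (act-θ^ j cs v))

    θ^-• : ∀ j a v → θ^ j (a • v) ≡ a • θ^ j v
    θ^-• zero a v = refl
    θ^-• (suc j) a v = trans (cong θ (θ^-• j a v)) (θ-• a _)

    θ-basis : ∀ j → suc j ℕ.< n → θ (basis j) ≡ basis (suc j)
    θ-basis j j<n = trans
      (cong (λ z → push z (basis j)) (trans (cong (α *_) (lastOr-basis-< j j<n)) (zeroʳ α)))
      (push-basis j)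

    comb : ℕ → Vec Carrier k → V
    comb j [] = 0̂
    comb j (c ∷ cs) = c • basis j ⊕ comb (suc j) cs

    -- With j + k = n no degree reaches n, so xⁿ = α never intervenes; the offset j is what the
    -- induction moves. A single coefficient is a case of its own because `θ (basis j)` would wrap
    -- around there.
    act-basis : ∀ j (cs : Vec Carrier k) → j ℕ.+ k ≡ n → act cs (basis j) ≡ comb j cs
    act-basis j [] _ = refl
    act-basis j (c ∷ []) _ = cong (c • basis j ⊕_) θ-0
    act-basis {suc (suc k)} j (c ∷ cs@(_ ∷ _)) eq = cong (c • basis j ⊕_) (begin
      θ (act cs (basis j)) ≡⟨ sym (act-θ cs (basis j)) ⟩
      act cs (θ (basis j)) ≡⟨ cong (act cs) (θ-basis j (subst (suc j ℕ.<_) j+2+k≡n (ℕ.s≤s (ℕ.s≤s (ℕP.m≤m+n j k))))) ⟩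
      act cs (basis (suc j)) ≡⟨ act-basis (suc j) cs (trans (sym (ℕP.+-suc j (suc k))) eq) ⟩
      comb (suc j) cs ∎)
      where
      j+2+k≡n : suc (suc (j ℕ.+ k)) ≡ n
      j+2+k≡n = trans (cong suc (sym (ℕP.+-suc j k))) (trans (sym (ℕP.+-suc j (suc k))) eq)

  comb-suc : ∀ {n} α β j (cs : Vec Carrier k) → comb (suc n) α (suc j) cs ≡ 0# ∷ comb n β j cs
  comb-suc α β j [] = refl
  comb-suc α β j (c ∷ cs) = trans
    (cong (c • basis (suc j) ⊕_) (comb-suc α β (suc j) cs))
    (cong (_∷ (c • basis j ⊕ comb _ β (suc j) cs)) (trans (+-identityʳ _) (zeroʳ c)))

  comb-id : ∀ {n} α (v : Vec Carrier n) → comb n α 0 v ≡ v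
  comb-id α [] = refl
  comb-id α (c ∷ cs) = trans
    (cong (c • basis 0 ⊕_) (comb-suc α α 0 cs))
    (cong₂ _∷_ (trans (+-identityʳ _) (*-identityʳ c))
      (trans (cong₂ _⊕_ (•-0 c) (comb-id α cs)) (⊕-identityˡ cs)))

  module _ (n : ℕ) (α : Carrier) where

    act-one : ∀ v → act n α v (one n α) ≡ v
    act-one v = trans (act-basis n α 0 v refl) (comb-id α v)

    θ^-one : ∀ j → j ℕ.< n → θ^ n α j (one n α) ≡ basis j
    θ^-one zero _ = refl
    θ^-one (suc j) j<n = trans (cong (θ n α) (θ^-one j (ℕP.<-trans (ℕP.n<1+n j) j<n))) (θ-basis n α j j<n)

    -- It suffices to know this for `one`: every v is a polynomial in `θ` applied to `one`, and such
    -- polynomials commute with powers of `θ`.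
    θ-cycle : ∀ v → θ^ n α n v ≡ α • v
    θ-cycle v = begin
      θ^ n α n v                     ≡⟨ cong (θ^ n α n) (sym (act-one v)) ⟩
      θ^ n α n (act n α v (one n α)) ≡⟨ sym (act-θ^ n α n v _) ⟩
      act n α v (θ^ n α n (one n α)) ≡⟨ cong (act n α v) θ^n-one ⟩
      act n α v (α • one n α)        ≡⟨ act-•ʳ n α v α _ ⟩
      α • act n α v (one n α)        ≡⟨ cong (α •_) (act-one v) ⟩
      α • v                          ∎
      where
      push-0̂ : ∀ c → push c (0̂ {n}) ≡ c • basis 0
      push-0̂ c = trans (cong₂ push (sym (*-identityʳ c)) (sym (•-0 c)))
        (trans (push-• c 1# 0̂) (cong (c •_) push-1-0̂))

      push-last : ∀ c m → n ≡ suc m → push c (basis {n} m) ≡ c • basis 0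
      push-last c m refl = begin
        push c (basis m) ≡⟨ cong₂ push (sym (+-identityʳ c)) (sym (⊕-identityˡ _)) ⟩
        push (c + 0#) (0̂ ⊕ basis m) ≡⟨ push-⊕ c 0# 0̂ (basis m) ⟩
        push c 0̂ ⊕ push 0# (basis m) ≡⟨ cong₂ _⊕_ (push-0̂ c) (trans (push-basis m) (basis-overflow (suc m))) ⟩
        c • basis 0 ⊕ 0̂ ≡⟨ ⊕-identityʳ _ ⟩
        c • basis 0 ∎

      top : ∀ m → n ≡ suc m → θ n α (basis m) ≡ α • one n α
      top m refl = trans
        (cong (λ z → push z (basis m)) (trans (cong (α *_) (lastOr-basis 0# m)) (*-identityʳ α)))
        (push-last α m refl)

      from-pred : ∀ m → m ≡ n → θ^ n α m (one n α) ≡ α • one n α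
      from-pred zero refl = refl
      from-pred (suc m) refl = trans (cong (θ n α) (θ^-one m (ℕP.n<1+n m))) (top m refl)

      θ^n-one : θ^ n α n (one n α) ≡ α • one n α
      θ^n-one = from-pred n refl

    -- `push c v` is the polynomial c + x v without its top coefficient; the second summand restores
    -- that coefficient, which sits in degree k.
    act-push : ∀ c (v : Vec Carrier k) w →
      act n α (push c v) w ⊕ θ^ n α k (lastOr c v • w) ≡ c • w ⊕ θ n α (act n α v w)
    act-push c [] w = trans (⊕-identityˡ _) (sym (trans (cong (c • w ⊕_) (θ-0 n α)) (⊕-identityʳ _)))
    act-push {suc k} c (x ∷ v) w = begin
      (c • w ⊕ θ n α (act n α (push x v) w)) ⊕ θ n α (θ^ n α k (lastOr x v • w))
        ≡⟨ ⊕-assoc _ _ _ ⟩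
      c • w ⊕ (θ n α (act n α (push x v) w) ⊕ θ n α (θ^ n α k (lastOr x v • w)))
        ≡⟨ cong (c • w ⊕_) (sym (θ-⊕ n α _ _)) ⟩
      c • w ⊕ θ n α (act n α (push x v) w ⊕ θ^ n α k (lastOr x v • w))
        ≡⟨ cong (λ z → c • w ⊕ θ n α z) (act-push x v w) ⟩
      c • w ⊕ θ n α (act n α (x ∷ v) w) ∎

  lastOr-irr : ∀ c d (v : Vec Carrier (suc k)) → lastOr c v ≡ lastOr d v
  lastOr-irr c d (x ∷ v) = refl

  ⊕-cancelʳ : ∀ (u v w : Vec Carrier k) → u ⊕ w ≡ v ⊕ w → u ≡ v
  ⊕-cancelʳ [] [] [] _ = refl
  ⊕-cancelʳ (x ∷ u) (y ∷ v) (z ∷ w) eq = cong₂ _∷_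
    (+-cancelʳ z x y (proj₁ (∷-injective eq)))
    (⊕-cancelʳ u v w (proj₂ (∷-injective eq)))

  -- The last coordinate t of v leaves in degree n and re-enters as α t in degree 0. By `θ-cycle`
  -- both account for the same vector α t w; adding it to each side reduces the claim to `act-push`.
  act-θˡ : ∀ n α v w → act n α (θ n α v) w ≡ θ n α (act n α v w)
  act-θˡ zero α v [] = []-unique _ _
    where
    []-unique : ∀ (u v : Vec Carrier 0) → u ≡ v
    []-unique [] [] = refl
  act-θˡ n@(suc _) α v w = ⊕-cancelʳ _ _ (α • (t • w)) (begin
    act n α (θ n α v) w ⊕ α • (t • w)
      ≡⟨ cong (act n α (θ n α v) w ⊕_) (sym (trans (θ^-• n α n _ w)
           (trans (cong (lastOr (α * t) v •_) (θ-cycle n α w)) (trans (•-comm _ α w) (cong (λ z → α • (z • w)) (lastOr-irr _ _ v)))))) ⟩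
    act n α (θ n α v) w ⊕ θ^ n α n (lastOr (α * t) v • w)
      ≡⟨ act-push n α (α * t) v w ⟩
    (α * t) • w ⊕ θ n α (act n α v w)
      ≡⟨ cong (_⊕ θ n α (act n α v w)) (*-• α t w) ⟩
    α • (t • w) ⊕ θ n α (act n α v w)
      ≡⟨ ⊕-comm _ _ ⟩
    θ n α (act n α v w) ⊕ α • (t • w) ∎)
    where t = lastOr 0# v

  act-act : ∀ n α (u : Vec Carrier k) v w → act n α (act n α u v) w ≡ act n α u (act n α v w)
  act-act n α [] v w = act-0ˡ n
    where
    act-0ˡ : ∀ k → act n α (0̂ {k}) w ≡ 0̂
    act-0ˡ zero = refl
    act-0ˡ (suc k) = trans (cong₂ _⊕_ (0-• w) (trans (cong (θ n α) (act-0ˡ k)) (θ-0 n α))) (⊕-identityˡ 0̂)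
  act-act n α (c ∷ cs) v w = trans (act-⊕ˡ n α (c • v) _ w)
    (cong₂ _⊕_ (act-•ˡ n α c v w)
      (trans (act-θˡ n α (act n α cs v) w) (cong (θ n α) (act-act n α cs v w))))

  Int-⊕ : ∀ {u v : Vec Carrier k} → All Int u → All Int v → All Int (u ⊕ v)
  Int-⊕ [] [] = []
  Int-⊕ (p ∷ ps) (q ∷ qs) = Int-+ p q ∷ Int-⊕ ps qs

  Int-• : ∀ {c} {v : Vec Carrier k} → Int c → All Int v → All Int (c • v)
  Int-• p [] = []
  Int-• p (q ∷ qs) = Int-* p q ∷ Int-• p qs

  Int-0̂ : All Int (0̂ {k})
  Int-0̂ {zero} = []
  Int-0̂ {suc k} = Int-0 ∷ Int-0̂

  Int-push : ∀ {c} {v : Vec Carrier k} → Int c → All Int v → All Int (push c v)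
  Int-push p [] = []
  Int-push p (q ∷ qs) = p ∷ Int-push q qs

  Int-lastOr : ∀ {c} {v : Vec Carrier k} → Int c → All Int v → Int (lastOr c v)
  Int-lastOr p [] = p
  Int-lastOr p (q ∷ qs) = Int-lastOr q qs

  Int-one : ∀ n α → All Int (one n α)
  Int-one zero α = []
  Int-one (suc n) α = Int-1 ∷ Int-0̂

  Int-θ : ∀ n {α} → Int α → {v : Vec Carrier n} → All Int v → All Int (θ n α v)
  Int-θ n p q = Int-push (Int-* p (Int-lastOr Int-0 q)) q

  Int-act : ∀ n {α} → Int α → {u : Vec Carrier k} {v : Vec Carrier n} → All Int u → All Int v → All Int (act n α u v)
  Int-act n p [] q = Int-0̂
  Int-act n p (r ∷ rs) q = Int-⊕ (Int-• r q) (Int-θ n p (Int-act n p rs q))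

  quotient : (n : ℕ) (α : Carrier) → Int α → Algebra
  quotient n α Int-α = record
    { Carrier = Vec Carrier n
    ; _+_ = _⊕_
    ; _*_ = act n α
    ; -_ = map (-_)
    ; 0# = 0̂
    ; 1# = one n α
    ; isCommutativeRing = record
      { isRing = record
        { +-isAbelianGroup = record
          { isGroup = record
            { isMonoid = record
              { isSemigroup = record
                { isMagma = record { isEquivalence = isEquivalence ; ∙-cong = cong₂ _⊕_ }
                ; assoc = ⊕-assoc }
              ; identity = ⊕-identityˡ , ⊕-identityʳ }
            ; inverse = zipWith-inverseˡ -‿inverseˡ , zipWith-inverseʳ -‿inverseʳ
            ; ⁻¹-cong = cong (map (-_)) }
          ; comm = ⊕-comm }
        ; *-cong = cong₂ (act n α)
        ; *-assoc = act-act n α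
        ; *-identity = (λ v → trans (act-comm′ (one n α) v) (act-one n α v)) , act-one n α
        ; distrib = act-⊕ʳ n α , λ w u v → act-⊕ˡ n α u v w }
      ; *-comm = act-comm′ }
    ; ι = λ q → ι q • one n α
    ; ι-+ = λ p q → trans (cong (_• one n α) (ι-+ p q)) (+-• _ _ _)
    ; ι-* = λ p q → begin
        ι (p ℚ.* q) • one n α ≡⟨ cong (_• one n α) (ι-* p q) ⟩
        (ι p * ι q) • one n α ≡⟨ *-• _ _ _ ⟩
        ι p • (ι q • one n α) ≡⟨ cong (ι p •_) (sym (trans (act-comm′ (one n α) (ι q • one n α)) (act-one n α (ι q • one n α)))) ⟩
        ι p • act n α (one n α) (ι q • one n α) ≡⟨ sym (act-•ˡ n α (ι p) (one n α) _) ⟩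
        act n α (ι p • one n α) (ι q • one n α) ∎
    ; ι-1 = trans (cong (_• one n α) ι-1) (1-• _)
    ; Int = All Int
    ; Int-+ = Int-⊕
    ; Int-* = Int-act n Int-α
    ; Int-ι = λ c → Int-• (Int-ι c) (Int-one n α)
    }
    where
    act-comm′ : ∀ u v → act n α u v ≡ act n α v u
    act-comm′ u v = begin
      act n α u v ≡⟨ cong (act n α u) (sym (act-one n α v)) ⟩
      act n α u (act n α v (one n α)) ≡⟨ act-comm n α u v _ ⟩
      act n α v (act n α u (one n α)) ≡⟨ cong (act n α v) (act-one n α u) ⟩
      act n α v u ∎

-- The rational numbers as an algebra

toℚᵘ-fromℤ : ∀ c → ℚ.toℚᵘ (fromℤ c) ℚᵘ.≃ ℚᵘ.mkℚᵘ c 0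
toℚᵘ-fromℤ c rewrite fromℤ-/1 c = ℚP.toℚᵘ-fromℚᵘ (ℚᵘ.mkℚᵘ c 0)

fromℤ-+ : ∀ c d → fromℤ (c ℤ.+ d) ≡ fromℤ c ℚ.+ fromℤ d
fromℤ-+ c d = ℚP.toℚᵘ-injective (ℚᵘP.≃-trans (toℚᵘ-fromℤ (c ℤ.+ d)) (ℚᵘP.≃-sym
  (ℚᵘP.≃-trans (ℚP.toℚᵘ-homo-+ (fromℤ c) (fromℤ d))
    (ℚᵘP.≃-trans (ℚᵘP.+-cong (toℚᵘ-fromℤ c) (toℚᵘ-fromℤ d))
      (ℚᵘ.*≡* (cong (ℤ._* + 1) (cong₂ ℤ._+_ (ℤP.*-identityʳ c) (ℤP.*-identityʳ d))))))))

fromℤ-* : ∀ c d → fromℤ (c ℤ.* d) ≡ fromℤ c ℚ.* fromℤ d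
fromℤ-* c d = ℚP.toℚᵘ-injective (ℚᵘP.≃-trans (toℚᵘ-fromℤ (c ℤ.* d)) (ℚᵘP.≃-sym
  (ℚᵘP.≃-trans (ℚP.toℚᵘ-homo-* (fromℤ c) (fromℤ d))
    (ℚᵘP.≃-trans (ℚᵘP.*-cong (toℚᵘ-fromℤ c) (toℚᵘ-fromℤ d)) (ℚᵘ.*≡* refl)))))

fromℤ-injective : ∀ {c d} → fromℤ c ≡ fromℤ d → c ≡ d
fromℤ-injective {c} {d} eq
  with ℚᵘP.≃-trans (ℚᵘP.≃-sym (toℚᵘ-fromℤ c)) (ℚᵘP.≃-trans (ℚP.toℚᵘ-cong eq) (toℚᵘ-fromℤ d))
... | ℚᵘ.*≡* e = trans (sym (ℤP.*-identityʳ c)) (trans e (ℤP.*-identityʳ d))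

inverse : ∀ d → (+ 1 ℚ./ suc d) ℚ.* fromℤ (+ suc d) ≡ 1ℚ
inverse d = ℚP.toℚᵘ-injective (ℚᵘP.≃-trans (ℚP.toℚᵘ-homo-* (+ 1 ℚ./ suc d) (fromℤ (+ suc d)))
  (ℚᵘP.≃-trans (ℚᵘP.*-cong (ℚP.toℚᵘ-fromℚᵘ (ℚᵘ.mkℚᵘ (+ 1) d)) (toℚᵘ-fromℤ (+ suc d)))
    (ℚᵘ.*≡* (ℤP.*-assoc (+ 1) (+ suc d) (+ 1)))))

rationals : Algebra
rationals = record
  { isCommutativeRing = CommutativeRing.isCommutativeRing ℚP.+-*-commutativeRing
  ; ι = λ q → q
  ; ι-+ = λ p q → refl
  ; ι-* = λ p q → refl
  ; ι-1 = refl
  ; Int = λ q → Σ ℤ λ c → q ≡ fromℤ c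
  ; Int-+ = λ { (c , refl) (d , refl) → c ℤ.+ d , sym (fromℤ-+ c d) }
  ; Int-* = λ { (c , refl) (d , refl) → c ℤ.* d , sym (fromℤ-* c d) }
  ; Int-ι = λ c → c , refl
  }

-- Bounded elements

module Boundedness (A : Algebra) where
  open Algebra A

  ν : ℕ → Carrier
  ν k = ι (fromℤ (+ k))

  ν-0 : ν 0 ≡ 0#
  ν-0 = trans (cong ι (fromℤ-/1 (+ 0))) ι-0

  ν-1 : ν 1 ≡ 1#
  ν-1 = trans (cong ι (fromℤ-/1 (+ 1))) ι-1

  ν-* : ∀ m n → ν (m ℕ.* n) ≡ ν m * ν n
  ν-* m n = trans (cong (λ z → ι (fromℤ z)) (ℤP.pos-* m n)) (trans (cong ι (fromℤ-* (+ m) (+ n))) (ι-* _ _))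

  ν-+ : ∀ m n → ν (m ℕ.+ n) ≡ ν m + ν n
  ν-+ m n = trans (cong (λ z → ι (fromℤ z)) (ℤP.pos-+ m n)) (trans (cong ι (fromℤ-+ (+ m) (+ n))) (ι-+ _ _))

  ν⁻¹ : ℕ → Carrier
  ν⁻¹ d = ι (+ 1 ℚ./ suc d)

  ν⁻¹-inverse : ∀ d → ν⁻¹ d * ν (suc d) ≡ 1#
  ν⁻¹-inverse d = trans (sym (ι-* _ _)) (trans (cong ι (inverse d)) ι-1)

  ν-cancel : ∀ d {x y} → ν (suc d) * x ≡ ν (suc d) * y → x ≡ y
  ν-cancel d {x} {y} eq = trans (expand x) (trans (cong (ν⁻¹ d *_) eq) (sym (expand y)))
    where
    expand : ∀ x → x ≡ ν⁻¹ d * (ν (suc d) * x)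
    expand x = trans (sym (*-identityˡ x)) (trans (cong (_* x) (sym (ν⁻¹-inverse d))) (*-assoc _ _ x))

  Int-^ : ∀ {h} → Int h → ∀ m → Int (h ^ m)
  Int-^ p zero = Int-1
  Int-^ p (suc m) = Int-* p (Int-^ p m)

  -- Over the integers of a number field this is equivalent to integrality; unlike
  -- integrality it is visibly stable under sums and products.
  Bounded : Carrier → Set
  Bounded h = Σ ℕ λ d → ∀ m → Int (ν (suc d) * h ^ m)

  Clearable : Set
  Clearable = ∀ h → Σ ℕ λ d → Int (ν (suc d) * h)

  Int⇒Bounded : ∀ {h} → Int h → Bounded h
  Int⇒Bounded p = 0 , λ m → Int-* (Int-ι (+ 1)) (Int-^ p m)

  Bounded-* : ∀ {g h} → Bounded g → Bounded h → Bounded (g * h)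
  Bounded-* {g} {h} (d , p) (e , q) = _ , λ m → subst Int (begin
    (ν (suc d) * g ^ m) * (ν (suc e) * h ^ m)
      ≡⟨ solve 4 (λ a b c d → (a :* b) :* (c :* d) := (a :* c) :* (b :* d)) refl _ _ _ _ ⟩
    (ν (suc d) * ν (suc e)) * (g ^ m * h ^ m)
      ≡⟨ cong₂ _*_ (sym (ν-* (suc d) (suc e))) (sym (^-distrib-* g h m)) ⟩
    ν (suc d ℕ.* suc e) * (g * h) ^ m ∎) (Int-* (p m) (q m))

  Bounded-+ : ∀ {g h} → Bounded g → Bounded h → Bounded (g + h)
  Bounded-+ {g} {h} (d , p) (e , q) = _ , λ m →
    subst (λ z → Int (z * (g + h) ^ m))
      (trans (solve 2 (λ x y → (x :* con 1) :* (y :* con 1) := x :* y) refl _ _) (sym (ν-* (suc d) (suc e))))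
      (mixed m 0 0)
    where
    -- Carrying powers of g and h along lets (g + h)ᵐ be expanded one factor at a time, in place of
    -- the binomial theorem.
    mixed : ∀ m i j → Int ((ν (suc d) * g ^ i) * (ν (suc e) * h ^ j) * (g + h) ^ m)
    mixed zero i j = Int-* (Int-* (p i) (q j)) Int-1
    mixed (suc m) i j = subst Int
      (solve 7 (λ x y g h a b s →
          (x :* (g :* a)) :* (y :* b) :* s :+ (x :* a) :* (y :* (h :* b)) :* s
          := (x :* a) :* (y :* b) :* ((g :+ h) :* s))
        refl (ν (suc d)) (ν (suc e)) g h (g ^ i) (h ^ j) ((g + h) ^ m))
      (Int-+ (mixed m (suc i) j) (mixed m i (suc j)))

  Bounded-^ : ∀ {h} → Bounded h → ∀ m → Bounded (h ^ m)
  Bounded-^ p zero = Int⇒Bounded Int-1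
  Bounded-^ p (suc m) = Bounded-* p (Bounded-^ p m)

  poly : ∀ {k} → Vec Carrier k → Carrier → Carrier
  poly [] z = 0#
  poly (c ∷ cs) z = c + z * poly cs z

  Int-poly : ∀ {k} {cs : Vec Carrier k} → All Int cs → ∀ y z →
    (∀ i → i ℕ.< k → Int (y * z ^ i)) → Int (y * poly cs z)
  Int-poly [] y z _ = subst Int (sym (zeroʳ y)) Int-0
  Int-poly {cs = c ∷ cs} (p ∷ ps) y z q = subst Int
    (solve 4 (λ c y z r → c :* (y :* con 1) :+ (y :* z) :* r := y :* (c :+ z :* r)) refl c y z (poly cs z))
    (Int-+ (Int-* p (q 0 (ℕ.s≤s ℕ.z≤n)))
      (Int-poly ps (y * z) z λ i i<k → subst Int (sym (*-assoc y z _)) (q (suc i) (ℕ.s≤s i<k))))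

  clear-powers : Clearable → ∀ z N → Σ ℕ λ d → ∀ i → i ℕ.< N → Int (ν (suc d) * z ^ i)
  clear-powers clear z zero = 0 , λ _ ()
  clear-powers clear z (suc N) with clear-powers clear z N | clear (z ^ N)
  ... | d , p | e , q = _ , λ i i<1+N → subst Int (cong (_* z ^ i) (sym (ν-* (suc d) (suc e)))) (go i (ℕP.m<1+n⇒m<n∨m≡n i<1+N))
    where
    go : ∀ i → _ → Int (ν (suc d) * ν (suc e) * z ^ i)
    go i (inj₁ i<N) = subst Int (solve 3 (λ a b c → b :* (a :* c) := a :* b :* c) refl _ _ _) (Int-* (Int-ι _) (p i i<N))
    go i (inj₂ refl) = subst Int (sym (*-assoc _ _ _)) (Int-* (Int-ι _) q)

  monic⇒Bounded : Clearable → ∀ {N} z (cs : Vec Carrier N) → All Int cs → z ^ N ≡ poly cs z → Bounded z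
  -- In degree 0 the equation says 1 = 0, so that z equals 1.
  monic⇒Bounded clear {zero} z [] [] eq = Int⇒Bounded (subst Int 1≡z Int-1)
    where
    1≡z : 1# ≡ z
    1≡z = trans eq (trans (sym (zeroˡ z)) (trans (cong (_* z) (sym eq)) (*-identityˡ z)))
  monic⇒Bounded clear {suc N} z cs ps eq with clear-powers clear z (suc N)
  ... | d , p = d , λ m → subst Int (*-identityʳ _) (window m 0 (ℕ.s≤s ℕ.z≤n))
    where
    -- One denominator clears every window of N + 1 consecutive powers: when the window moves up by
    -- one, its new top power is, by the monic equation, an integral combination of the previous
    -- window.
    window : ∀ m i → i ℕ.< suc N → Int (ν (suc d) * z ^ m * z ^ i)
    window zero i i<N = subst Int (cong (_* z ^ i) (sym (*-identityʳ _))) (p i i<N)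
    window (suc m) i i<N with ℕP.m<1+n⇒m<n∨m≡n i<N
    ... | inj₁ i<N′ = subst Int (solve 4 (λ a b c d → a :* b :* (c :* d) := a :* (c :* b) :* d) refl _ _ _ _) (window m (suc i) (ℕ.s≤s i<N′))
    ... | inj₂ refl = subst Int (begin
      ν (suc d) * z ^ m * poly cs z    ≡⟨ cong (ν (suc d) * z ^ m *_) (sym eq) ⟩
      ν (suc d) * z ^ m * (z * z ^ N)  ≡⟨ solve 4 (λ a b c d → a :* b :* (c :* d) := a :* (c :* b) :* d) refl _ _ _ _ ⟩
      ν (suc d) * z ^ suc m * z ^ N    ∎) (Int-poly ps (ν (suc d) * z ^ m) z (window m))

-- Homomorphisms and evaluation of polynomials

record Hom (A B : Algebra) : Set where
  private
    module A = Algebra A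
    module B = Algebra B
  field
    fun : A.Carrier → B.Carrier
    hom-+ : ∀ x y → fun (x A.+ y) ≡ fun x B.+ fun y
    hom-* : ∀ x y → fun (x A.* y) ≡ fun x B.* fun y
    hom-ι : ∀ q → fun (A.ι q) ≡ B.ι q
    hom-Int : ∀ {x} → A.Int x → B.Int (fun x)

  hom-0 : fun A.0# ≡ B.0#
  hom-0 = trans (cong fun (sym A.ι-0)) (trans (hom-ι 0ℚ) B.ι-0)

  hom-1 : fun A.1# ≡ B.1#
  hom-1 = trans (cong fun (sym A.ι-1)) (trans (hom-ι 1ℚ) B.ι-1)

  hom-^ : ∀ x m → fun (x A.^ m) ≡ fun x B.^ m
  hom-^ x zero = hom-1
  hom-^ x (suc m) = trans (hom-* x _) (cong (fun x B.*_) (hom-^ x m))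

  hom-Bounded : ∀ {x} → Boundedness.Bounded A x → Boundedness.Bounded B (fun x)
  hom-Bounded {x} (d , p) = d , λ m → subst B.Int
    (trans (hom-* _ _) (cong₂ B._*_ (hom-ι _) (hom-^ x m))) (hom-Int (p m))

open Hom public using (fun)

id-hom : ∀ A → Hom A A
id-hom A = record
  { fun = λ x → x ; hom-+ = λ _ _ → refl ; hom-* = λ _ _ → refl ; hom-ι = λ _ → refl ; hom-Int = λ p → p }

infixr 9 _∘ʰ_
_∘ʰ_ : ∀ {A B C} → Hom B C → Hom A B → Hom A C
g ∘ʰ f = record
  { fun = λ x → fun g (fun f x)
  ; hom-+ = λ x y → trans (cong (fun g) (Hom.hom-+ f x y)) (Hom.hom-+ g _ _)
  ; hom-* = λ x y → trans (cong (fun g) (Hom.hom-* f x y)) (Hom.hom-* g _ _)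
  ; hom-ι = λ q → trans (cong (fun g) (Hom.hom-ι f q)) (Hom.hom-ι g q)
  ; hom-Int = λ p → Hom.hom-Int g (Hom.hom-Int f p)
  }

ι-hom : ∀ A → Hom rationals A
ι-hom A = record
  { fun = ι ; hom-+ = ι-+ ; hom-* = ι-* ; hom-ι = λ _ → refl ; hom-Int = λ { (c , refl) → Int-ι c } }
  where open Algebra A

module Evaluation {R S : Algebra} (φ : Hom R S) (s : Algebra.Carrier S) where
  private
    module R = Algebra R
    module Q = Quotient R
  open Algebra S
  open Hom φ using (hom-+; hom-*; hom-ι; hom-0; hom-1; hom-Int)

  eval : ∀ {k} → Vec R.Carrier k → Carrier
  eval [] = 0#
  eval (c ∷ cs) = fun φ c + s * eval cs

  eval-⊕ : ∀ {k} (u v : Vec R.Carrier k) → eval (u Q.⊕ v) ≡ eval u + eval v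
  eval-⊕ [] [] = sym (+-identityˡ 0#)
  eval-⊕ (c ∷ u) (d ∷ v) = trans (cong₂ (λ a b → a + s * b) (hom-+ c d) (eval-⊕ u v))
    (solve 5 (λ c d s u v → (c :+ d) :+ s :* (u :+ v) := (c :+ s :* u) :+ (d :+ s :* v)) refl _ _ s _ _)

  eval-• : ∀ {k} c (v : Vec R.Carrier k) → eval (c Q.• v) ≡ fun φ c * eval v
  eval-• c [] = sym (zeroʳ _)
  eval-• c (d ∷ v) = trans (cong₂ (λ a b → a + s * b) (hom-* c d) (eval-• c v))
    (solve 4 (λ c d s v → c :* d :+ s :* (c :* v) := c :* (d :+ s :* v)) refl _ _ s _)

  eval-0̂ : ∀ k → eval (Q.0̂ {k}) ≡ 0#
  eval-0̂ zero = refl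
  eval-0̂ (suc k) = trans (cong₂ (λ a b → a + s * b) hom-0 (eval-0̂ k)) (trans (+-identityˡ _) (zeroʳ s))

  eval-∷0̂ : ∀ c k → eval (c ∷ Q.0̂ {k}) ≡ fun φ c
  eval-∷0̂ c k = trans (cong (λ z → fun φ c + s * z) (eval-0̂ k))
    (solve 2 (λ c s → c :+ s :* con 0 := c) refl (fun φ c) s)

  eval-++ : ∀ {k l} (u : Vec R.Carrier k) (v : Vec R.Carrier l) → eval (u Vec.++ v) ≡ eval u + s ^ k * eval v
  eval-++ [] v = sym (trans (+-identityˡ _) (*-identityˡ _))
  eval-++ {suc k} (c ∷ u) v = trans (cong (λ z → fun φ c + s * z) (eval-++ u v))
    (solve 5 (λ c s u v t → c :+ s :* (u :+ t :* v) := (c :+ s :* u) :+ s :* t :* v) refl _ s _ _ (s ^ k))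

  Int-eval : Int s → ∀ {k} {v : Vec R.Carrier k} → All R.Int v → Int (eval v)
  Int-eval p [] = Int-0
  Int-eval p (q ∷ qs) = Int-+ (hom-Int q) (Int-* p (Int-eval p qs))

  eval-push : ∀ {k} c (v : Vec R.Carrier k) →
    eval (Q.push c v) + s ^ k * fun φ (Q.lastOr c v) ≡ fun φ c + s * eval v
  eval-push c [] = solve 2 (λ c s → con 0 :+ con 1 :* c := c :+ s :* con 0) refl (fun φ c) s
  eval-push {suc k} c (x ∷ v) = trans
    (solve 5 (λ c s e t l → (c :+ s :* e) :+ s :* t :* l := c :+ s :* (e :+ t :* l)) refl (fun φ c) s _ (s ^ k) _)
    (cong (λ z → fun φ c + s * z) (eval-push x v))

  module _ (n : ℕ) (α : R.Carrier) (s^n : s ^ n ≡ fun φ α) where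

    eval-θ : ∀ (v : Vec R.Carrier n) → eval (Q.θ n α v) ≡ s * eval v
    eval-θ [] = sym (zeroʳ s)
    eval-θ v@(_ ∷ _) = +-cancelʳ (fun φ (α R.* l)) _ _ (begin
      eval (Q.push (α R.* l) v) + fun φ (α R.* l)
        ≡⟨ cong₂ _+_ refl (trans (hom-* α l) (cong (_* fun φ l) (sym s^n))) ⟩
      eval (Q.push (α R.* l) v) + s ^ n * fun φ l
        ≡⟨ eval-push (α R.* l) v ⟩
      fun φ (α R.* l) + s * eval v
        ≡⟨ +-comm _ _ ⟩
      s * eval v + fun φ (α R.* l) ∎)
      where l = Q.lastOr R.0# v

    eval-act : ∀ {k} (u : Vec R.Carrier k) v → eval (Q.act n α u v) ≡ eval u * eval v
    eval-act [] v = trans (eval-0̂ n) (sym (zeroˡ _))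
    eval-act (c ∷ u) v = begin
      eval (c Q.• v Q.⊕ Q.θ n α (Q.act n α u v))
        ≡⟨ eval-⊕ (c Q.• v) _ ⟩
      eval (c Q.• v) + eval (Q.θ n α (Q.act n α u v))
        ≡⟨ cong₂ _+_ (eval-• c v) (trans (eval-θ (Q.act n α u v)) (cong (s *_) (eval-act u v))) ⟩
      fun φ c * eval v + s * (eval u * eval v)
        ≡⟨ solve 4 (λ c v s u → c :* v :+ s :* (u :* v) := (c :+ s :* u) :* v) refl _ _ s _ ⟩
      (fun φ c + s * eval u) * eval v ∎

  eval-hom : ∀ n α p → s ^ suc n ≡ fun φ α → Int s → Hom (Q.quotient (suc n) α p) S
  eval-hom n α p s^n Int-s = record
    { fun = eval
    ; hom-+ = eval-⊕
    ; hom-* = λ u v → eval-act (suc n) α s^n u v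
    ; hom-ι = λ q → trans (eval-• (R.ι q) (Q.one (suc n) α)) (trans (cong₂ _*_ (hom-ι q) (trans (eval-∷0̂ R.1# n) hom-1)) (*-identityʳ _))
    ; hom-Int = Int-eval Int-s
    }

module QuotientProperties (R : Algebra) (n : ℕ) (α : Algebra.Carrier R) (p : Algebra.Int R α) where
  private
    module R = Algebra R
    module Q = Quotient R
  open Q using (_•_; _⊕_; θ; act; one; 0̂)
  L = Q.quotient n α p
  open Algebra L

  X : Carrier
  X = θ n α (one n α)

  Int-X : Int X
  Int-X = Q.Int-θ n p (Q.Int-one n α)

  X* : ∀ v → X * v ≡ θ n α v
  X* v = trans (Q.act-θˡ n α (one n α) v) (cong (θ n α) (*-identityˡ v))

  X^* : ∀ j v → X ^ j * v ≡ Q.θ^ n α j v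
  X^* zero v = *-identityˡ v
  X^* (suc j) v = trans (*-assoc X (X ^ j) v) (trans (X* _) (cong (θ n α) (X^* j v)))

  •-* : ∀ c u v → (c • u) * v ≡ c • (u * v)
  •-* = Q.act-•ˡ n α

  •-one : ∀ c v → (c • 1#) * v ≡ c • v
  •-one c v = trans (•-* c 1# v) (cong (c •_) (*-identityˡ v))

  X^n : X ^ n ≡ α • 1#
  X^n = trans (sym (*-identityʳ _)) (trans (X^* n 1#) (Q.θ-cycle n α 1#))

  const-hom : Hom R L
  const-hom = record
    { fun = _• 1#
    ; hom-+ = λ x y → Q.+-• x y 1#
    ; hom-* = λ x y → trans (Q.*-• x y 1#) (sym (•-one x _))
    ; hom-ι = λ _ → refl
    ; hom-Int = λ q → Q.Int-• q (Q.Int-one n α)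
    }

  open Evaluation const-hom X using (eval)

  eval-X-act : ∀ {k} (v : Vec R.Carrier k) → eval v ≡ act n α v 1#
  eval-X-act [] = refl
  eval-X-act (c ∷ v) = cong (c • 1# ⊕_) (trans (X* _) (cong (θ n α) (eval-X-act v)))

  eval-X : ∀ v → eval v ≡ v
  eval-X v = trans (eval-X-act v) (Q.act-one n α v)

  quotient-Clearable : Boundedness.Clearable R → Boundedness.Clearable L
  quotient-Clearable clear h with go h
    where
    module B = Boundedness R
    go : ∀ {k} (v : Vec R.Carrier k) → Σ ℕ λ d → All R.Int (B.ν (suc d) • v)
    go [] = 0 , []
    go (c ∷ v) with clear c | go v
    ... | d , q | e , r = _ ,
      subst R.Int (trans (R.solve 3 (λ a b c → b R.:* (a R.:* c) R.:= (a R.:* b) R.:* c) refl _ _ _) (cong (R._* c) (sym (B.ν-* (suc d) (suc e))))) (R.Int-* (R.Int-ι _) q)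
      ∷ subst (All R.Int) (trans (sym (Q.*-• _ _ v)) (cong (_• v) (sym (B.ν-* (suc d) (suc e))))) (Q.Int-• (R.Int-ι _) r)
  ... | d , q = d , subst (All R.Int) (sym (•-one _ h)) q

-- Geometric sums of roots of unity

module Sums (A : Algebra) where
  open Algebra A
  open Boundedness A

  ∑< : ℕ → (ℕ → Carrier) → Carrier
  ∑< zero f = 0#
  ∑< (suc k) f = ∑< k f + f k

  ∑<-cong : ∀ k {f g} → (∀ i → f i ≡ g i) → ∑< k f ≡ ∑< k g
  ∑<-cong zero eq = refl
  ∑<-cong (suc k) eq = cong₂ _+_ (∑<-cong k eq) (eq k)

  ∑<-+ : ∀ k f g → ∑< k (λ i → f i + g i) ≡ ∑< k f + ∑< k g
  ∑<-+ zero f g = sym (+-identityˡ 0#)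
  ∑<-+ (suc k) f g = trans (cong (λ z → z + (f k + g k)) (∑<-+ k f g))
    (solve 4 (λ a b c d → (a :+ b) :+ (c :+ d) := (a :+ c) :+ (b :+ d)) refl _ _ _ _)

  ∑<-* : ∀ k c f → ∑< k (λ i → c * f i) ≡ c * ∑< k f
  ∑<-* zero c f = sym (zeroʳ c)
  ∑<-* (suc k) c f = trans (cong (_+ c * f k) (∑<-* k c f)) (sym (distribˡ c _ _))

  ∑<-0 : ∀ k → ∑< k (λ _ → 0#) ≡ 0#
  ∑<-0 zero = refl
  ∑<-0 (suc k) = trans (+-identityʳ _) (∑<-0 k)

  ∑<-Bounded : ∀ k f → (∀ i → Bounded (f i)) → Bounded (∑< k f)
  ∑<-Bounded zero f p = Int⇒Bounded Int-0
  ∑<-Bounded (suc k) f p = Bounded-+ (∑<-Bounded k f p) (p k)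

  1^ : ∀ k → 1# ^ k ≡ 1#
  1^ zero = refl
  1^ (suc k) = trans (*-identityˡ _) (1^ k)

  geometric-fixed : ∀ u p → u ^ p ≡ 1# → u * ∑< p (u ^_) ≡ ∑< p (u ^_)
  geometric-fixed u p u^p≡1 = +-cancelʳ 1# _ _ (trans (telescope p) (cong₂ _+_ refl u^p≡1))
    where
    telescope : ∀ k → u * ∑< k (u ^_) + 1# ≡ ∑< k (u ^_) + u ^ k
    telescope zero = solve 1 (λ u → u :* con 0 :+ con 1 := con 0 :+ con 1) refl u
    telescope (suc k) = begin
      u * (∑< k (u ^_) + u ^ k) + 1#
        ≡⟨ solve 3 (λ u s t → u :* (s :+ t) :+ con 1 := (u :* s :+ con 1) :+ u :* t) refl u _ _ ⟩
      (u * ∑< k (u ^_) + 1#) + u * u ^ k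
        ≡⟨ cong (_+ u * u ^ k) (telescope k) ⟩
      ∑< k (u ^_) + u ^ k + u * u ^ k ∎

  geometric-1 : ∀ p → ∑< p (1# ^_) ≡ ν p
  geometric-1 zero = sym ν-0
  geometric-1 (suc p) = trans (cong₂ _+_ (geometric-1 p) (trans (1^ p) (sym ν-1)))
    (trans (sym (ν-+ p 1)) (cong ν (ℕP.+-comm p 1)))

  -- To be used for the zero divisor e = 1 - w, which cannot be cancelled. Agreement after
  -- multiplication by e is still a ring congruence and so passes to powers.
  *-^-cong : ∀ e c {a b} → e * a ≡ e * b → ∀ j → e * (c * a ^ j) ≡ e * (c * b ^ j)
  *-^-cong e c {a} {b} ea≡eb zero = refl
  *-^-cong e c {a} {b} ea≡eb (suc j) = begin
    e * (c * (a * a ^ j)) ≡⟨ solve 4 (λ e c a t → e :* (c :* (a :* t)) := (e :* a) :* (c :* t)) refl e c a (a ^ j) ⟩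
    (e * a) * (c * a ^ j) ≡⟨ cong (_* (c * a ^ j)) ea≡eb ⟩
    (e * b) * (c * a ^ j) ≡⟨ solve 4 (λ e c b t → (e :* b) :* (c :* t) := b :* (e :* (c :* t))) refl e c b (a ^ j) ⟩
    b * (e * (c * a ^ j)) ≡⟨ cong (b *_) (*-^-cong e c ea≡eb j) ⟩
    b * (e * (c * b ^ j)) ≡⟨ solve 4 (λ e c b t → b :* (e :* (c :* t)) := e :* (c :* (b :* t))) refl e c b (b ^ j) ⟩
    e * (c * (b * b ^ j)) ∎

  fixed-^ : ∀ u g k → u * g ≡ g → u ^ k * g ≡ g
  fixed-^ u g zero _ = *-identityˡ g
  fixed-^ u g (suc k) eq = trans (*-assoc u _ g) (trans (cong (u *_) (fixed-^ u g k eq)) eq)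

  -- For p ∤ i the power wⁱ generates the same group as w.
  geometric-fixed-by-root : ∀ w p i → Prime p → w ^ p ≡ 1# → 0 ℕ.< i → i ℕ.< p →
    w * ∑< p ((w ^ i) ^_) ≡ ∑< p ((w ^ i) ^_)
  geometric-fixed-by-root w p i@(suc _) pr w^p≡1 _ i<p =
    go (Coprimality.coprime-Bézout (Coprimality.sym (Coprimality.prime⇒coprime pr i<p)))
    where
    g = ∑< p ((w ^ i) ^_)

    power-of-p : ∀ l → w ^ (p ℕ.* l) ≡ 1#
    power-of-p l = trans (sym (^-assocʳ w p l)) (trans (cong (_^ l) w^p≡1) (1^ l))

    fix : ∀ j → (w ^ i) ^ j * g ≡ g
    fix j = fixed-^ (w ^ i) g j (geometric-fixed (w ^ i) p
      (trans (^-assocʳ w i p) (trans (cong (w ^_) (ℕP.*-comm i p)) (power-of-p i))))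

    go : Bézout.Identity 1 i p → w * g ≡ g
    go (Bézout.+- j l 1+lp≡ji) = trans (cong (_* g) (sym w^ij≡w)) (fix j)
      where
      w^ij≡w : (w ^ i) ^ j ≡ w
      w^ij≡w = begin
        (w ^ i) ^ j       ≡⟨ ^-assocʳ w i j ⟩
        w ^ (i ℕ.* j)     ≡⟨ cong (w ^_) (trans (ℕP.*-comm i j) (trans (sym 1+lp≡ji) (cong suc (ℕP.*-comm l p)))) ⟩
        w * w ^ (p ℕ.* l) ≡⟨ cong (w *_) (power-of-p l) ⟩
        w * 1#            ≡⟨ *-identityʳ w ⟩
        w ∎
    go (Bézout.-+ j l 1+ji≡lp) = begin
      w * g                 ≡⟨ cong (w *_) (sym (fix j)) ⟩
      w * ((w ^ i) ^ j * g) ≡⟨ sym (*-assoc w _ g) ⟩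
      w * (w ^ i) ^ j * g   ≡⟨ cong (_* g) (trans (cong (w *_) (^-assocʳ w i j))
          (trans (cong (w ^_) (trans (cong suc (ℕP.*-comm i j)) (trans 1+ji≡lp (ℕP.*-comm l p)))) (power-of-p l))) ⟩
      1# * g                ≡⟨ *-identityˡ g ⟩
      g                     ∎

-- The trace, one prime factor of the exponent at a time

-- The trace of v = v(x) from L = R[x]/(xᵐᵖ - α) down to R[xᵖ] for a prime p is the sum of the
-- conjugates v(wᵏ x) with wᵖ = 1. As w need not be a primitive root of unity (it is the
-- generator of L[w]/(wᵖ - 1)), this only holds after multiplication by 1 - w.
module ConjugateSum {R L E : Algebra} (χ : Hom R L) (κ : Hom L E) (X : Algebra.Carrier L) (w : Algebra.Carrier E)
                    (p″ : ℕ) (pr : Prime (suc (suc p″))) (w^p : Algebra._^_ E w (suc (suc p″)) ≡ Algebra.1# E) where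
  p = suc (suc p″)
  private
    module R = Algebra R
    module BR = Boundedness R
    module L = Algebra L
  open Algebra E
  open Boundedness E using (Bounded; Bounded-*; Int⇒Bounded; Int-^; ν)
  open Sums E

  x : Carrier
  x = fun κ X

  φ : Hom R E
  φ = κ ∘ʰ χ

  module F (k : ℕ) = Evaluation φ (w ^ k * x)

  conjugate-^ : ∀ k m {a} → X L.^ (m ℕ.* p) ≡ fun χ a → (w ^ k * x) ^ (m ℕ.* p) ≡ fun φ a
  conjugate-^ k m {a} X^mp = begin
    (w ^ k * x) ^ (m ℕ.* p)               ≡⟨ ^-distrib-* (w ^ k) x (m ℕ.* p) ⟩
    (w ^ k) ^ (m ℕ.* p) * x ^ (m ℕ.* p)   ≡⟨ cong₂ _*_ root (trans (sym (Hom.hom-^ κ X (m ℕ.* p))) (cong (fun κ) X^mp)) ⟩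
    1# * fun φ a                          ≡⟨ *-identityˡ _ ⟩
    fun φ a                               ∎
    where
    root : (w ^ k) ^ (m ℕ.* p) ≡ 1#
    root = begin
      (w ^ k) ^ (m ℕ.* p)     ≡⟨ ^-assocʳ w k (m ℕ.* p) ⟩
      w ^ (k ℕ.* (m ℕ.* p))   ≡⟨ cong (w ^_) (trans (sym (ℕP.*-assoc k m p)) (ℕP.*-comm (k ℕ.* m) p)) ⟩
      w ^ (p ℕ.* (k ℕ.* m))   ≡⟨ sym (^-assocʳ w p (k ℕ.* m)) ⟩
      (w ^ p) ^ (k ℕ.* m)     ≡⟨ trans (cong (_^ (k ℕ.* m)) w^p) (1^ (k ℕ.* m)) ⟩
      1# ∎

  -- For u = 1 this is the sum of the conjugates. Splitting off the lowest coefficient replaces u by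
  -- w u, so after i such steps the next coefficient meets the geometric sum of wⁱ.
  twisted : ∀ {k} → Carrier → Vec R.Carrier k → Carrier
  twisted u v = ∑< p (λ k → u ^ k * F.eval k v)

  twisted-∷ : ∀ {k} u c (v : Vec R.Carrier k) → twisted u (c ∷ v) ≡ fun φ c * ∑< p (u ^_) + x * twisted (w * u) v
  twisted-∷ u c v = begin
    ∑< p (λ k → u ^ k * (fun φ c + w ^ k * x * F.eval k v))
      ≡⟨ ∑<-cong p (λ k → trans
           (solve 5 (λ u c w x f → u :* (c :+ w :* x :* f) := c :* u :+ x :* ((w :* u) :* f)) refl (u ^ k) (fun φ c) (w ^ k) x (F.eval k v))
           (cong (λ z → fun φ c * u ^ k + x * (z * F.eval k v)) (sym (^-distrib-* w u k)))) ⟩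
    ∑< p (λ k → fun φ c * u ^ k + x * ((w * u) ^ k * F.eval k v))
      ≡⟨ ∑<-+ p _ _ ⟩
    ∑< p (λ k → fun φ c * u ^ k) + ∑< p (λ k → x * ((w * u) ^ k * F.eval k v))
      ≡⟨ cong₂ _+_ (∑<-* p _ _) (∑<-* p _ _) ⟩
    fun φ c * ∑< p (u ^_) + x * twisted (w * u) v ∎

  e : Carrier
  e = 1# + - w

  e* : ∀ y → e * y ≡ y + - (w * y)
  e* y = trans (distribʳ y 1# (- w)) (cong₂ _+_ (*-identityˡ y) (sym (-‿distribˡ-* w y)))

  e*-fixed : ∀ g → w * g ≡ g → e * g ≡ 0#
  e*-fixed g eq = trans (e* g) (trans (cong (λ z → g + - z) eq) (-‿inverseʳ g))

  -- The coefficients in degrees i, ..., p - 1 meet the geometric sums of wⁱ, ..., wᵖ⁻¹, which are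
  -- fixed by w and hence killed by e = 1 - w. In degree p the twist has returned to wᵖ = 1.
  twisted-block : ∀ {k l} i (b : Vec R.Carrier k) (v : Vec R.Carrier l) → 0 ℕ.< i → i ℕ.+ k ≡ p →
    e * twisted (w ^ i) (b Vec.++ v) ≡ x ^ k * (e * twisted 1# v)
  twisted-block i [] v _ eq = trans
    (cong (λ z → e * twisted z v) (trans (cong (w ^_) (trans (sym (ℕP.+-identityʳ i)) eq)) w^p))
    (sym (*-identityˡ _))
  twisted-block {suc k} i (c ∷ b) v 0<i eq = begin
    e * twisted (w ^ i) (c ∷ (b Vec.++ v))
      ≡⟨ cong (e *_) (twisted-∷ (w ^ i) c (b Vec.++ v)) ⟩
    e * (fun φ c * ∑< p ((w ^ i) ^_) + x * twisted (w ^ suc i) (b Vec.++ v))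
      ≡⟨ solve 5 (λ e c g x t → e :* (c :* g :+ x :* t) := c :* (e :* g) :+ x :* (e :* t)) refl e _ _ x _ ⟩
    fun φ c * (e * ∑< p ((w ^ i) ^_)) + x * (e * twisted (w ^ suc i) (b Vec.++ v))
      ≡⟨ cong₂ (λ a b → fun φ c * a + x * b)
           (e*-fixed _ (geometric-fixed-by-root w p i pr w^p 0<i i<p))
           (twisted-block (suc i) b v (ℕ.s≤s ℕ.z≤n) (trans (sym (ℕP.+-suc i k)) eq)) ⟩
    fun φ c * 0# + x * (x ^ k * (e * twisted 1# v))
      ≡⟨ solve 4 (λ c x y t → c :* con 0 :+ x :* (y :* t) := (x :* y) :* t) refl _ x _ _ ⟩
    x ^ suc k * (e * twisted 1# v) ∎
    where
    i<p : i ℕ.< p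
    i<p = subst (i ℕ.<_) eq (ℕP.m<m+n i (ℕ.s≤s ℕ.z≤n))

  -- The trace as a polynomial in xᵖ: a coefficient in a degree divisible by p occurs alike in all p
  -- conjugates, hence the factor p.
  pick : ∀ k → Vec R.Carrier (k ℕ.* p) → Vec R.Carrier k
  pick zero _ = []
  pick (suc k) (c ∷ v) = BR.ν p R.* c ∷ pick k (drop (suc p″) v)

  module T = Evaluation χ (X L.^ p)

  twisted-pick : ∀ k v → e * twisted 1# v ≡ e * fun κ (T.eval (pick k v))
  twisted-pick zero [] = cong (e *_) (trans (∑<-cong p λ k → zeroʳ _) (trans (∑<-0 p) (sym (Hom.hom-0 κ))))
  twisted-pick (suc k) (c ∷ v) = begin
    e * twisted 1# (c ∷ v)
      ≡⟨ cong (e *_) (twisted-∷ 1# c v) ⟩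
    e * (fun φ c * ∑< p (1# ^_) + x * twisted (w ^ 1) v)
      ≡⟨ cong (λ z → e * (fun φ c * z + x * twisted (w ^ 1) v)) (geometric-1 p) ⟩
    e * (fun φ c * ν p + x * twisted (w ^ 1) v)
      ≡⟨ solve 5 (λ e c n x t → e :* (c :* n :+ x :* t) := e :* (n :* c) :+ x :* (e :* t)) refl e _ _ x _ ⟩
    e * (ν p * fun φ c) + x * (e * twisted (w ^ 1) v)
      ≡⟨ cong₂ (λ a b → e * a + x * b)
           (sym (trans (Hom.hom-* φ _ c) (cong (_* fun φ c) (Hom.hom-ι φ _))))
           (trans (cong (λ z → e * twisted (w ^ 1) z) (sym (take++drop≡id (suc p″) v)))
             (trans (twisted-block 1 (take (suc p″) v) rest (ℕ.s≤s ℕ.z≤n) refl)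
               (cong (x ^ suc p″ *_) (twisted-pick k rest)))) ⟩
    e * fun φ (BR.ν p R.* c) + x * (x ^ suc p″ * (e * fun κ (T.eval (pick k rest))))
      ≡⟨ solve 5 (λ e c x y t → e :* c :+ x :* (y :* (e :* t)) := e :* (c :+ (x :* y) :* t)) refl e _ x _ _ ⟩
    e * (fun φ (BR.ν p R.* c) + x ^ p * fun κ (T.eval (pick k rest)))
      ≡⟨ cong (λ z → e * (fun φ (BR.ν p R.* c) + z)) (trans (cong (_* fun κ (T.eval (pick k rest))) (sym (Hom.hom-^ κ X p))) (sym (Hom.hom-* κ _ _))) ⟩
    e * (fun φ (BR.ν p R.* c) + fun κ (X L.^ p L.* T.eval (pick k rest)))
      ≡⟨ cong (e *_) (sym (Hom.hom-+ κ _ _)) ⟩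
    e * fun κ (T.eval (pick (suc k) (c ∷ v))) ∎
    where rest = drop (suc p″) v

  module _ {A : Algebra} (ψ : Hom A L) (Int-w : Int w) (Int-e*⁻ : ∀ y → Int (e * fun κ y) → L.Int y) where
    private module A = Algebra A

    private
      conjugates-Bounded : ∀ {k} (v : Vec R.Carrier k) → (∀ i → Bounded (F.eval i v)) → Bounded (twisted 1# v)
      conjugates-Bounded v bv = ∑<-Bounded p (λ i → 1# ^ i * F.eval i v)
        (λ i → Bounded-* (Int⇒Bounded (Int-^ Int-1 i)) (bv i))

      Int-e : Int e
      Int-e = Int-+ Int-1 (subst Int (-1*x≈-x w) (Int-* Int--1 Int-w))

    -- A sum of bounded conjugates is bounded, and its powers agree with those of the trace after
    -- multiplication by e; `Int-e*⁻` then removes e. The denominator d is the same for all powers.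
    pick-power-Bounded : ∀ k (v : Vec R.Carrier (k ℕ.* p)) → (∀ i → Bounded (F.eval i v)) →
      ∀ t → fun ψ t ≡ T.eval (pick k v) → Σ ℕ λ d → ∀ j → L.Int (fun ψ (A.ι (fromℤ (+ suc d)) A.* t A.^ j))
    pick-power-Bounded k v bv t ψt = go (conjugates-Bounded v bv)
      where
      y : Carrier
      y = fun κ (fun ψ t)
      e*y : e * twisted 1# v ≡ e * y
      e*y = trans (twisted-pick k v) (cong (λ z → e * fun κ z) (sym ψt))
      image : ∀ d j → ν (suc d) * y ^ j ≡ fun κ (fun ψ (A.ι (fromℤ (+ suc d)) A.* t A.^ j))
      image d j = sym (trans (Hom.hom-* (κ ∘ʰ ψ) (A.ι (fromℤ (+ suc d))) (t A.^ j))
        (cong₂ _*_ (Hom.hom-ι (κ ∘ʰ ψ) (fromℤ (+ suc d))) (Hom.hom-^ (κ ∘ʰ ψ) t j)))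
      go : Bounded (twisted 1# v) → _
      go (d , q) = d , λ j → Int-e*⁻ _ (subst Int
        (trans (*-^-cong e (ν (suc d)) e*y j) (cong (e *_) (image d j)))
        (Int-* Int-e (q j)))

module PrimeTrace (R : Algebra) (m′ p″ : ℕ) (α : Algebra.Carrier R) (Int-α : Algebra.Int R α)
                  (pr : Prime (suc (suc p″))) where
  private
    p = suc (suc p″)
    m = suc m′
    module R = Algebra R
    module Q = Quotient R
    module QL = QuotientProperties R (m ℕ.* p) α Int-α
    L = QL.L
    module L = Algebra L
    module QE = QuotientProperties L p L.1# L.Int-1
    E = QE.L
    module E = Algebra E
    module A = Algebra (Q.quotient m α Int-α)

  w^p : QE.X E.^ p ≡ E.1#
  w^p = trans QE.X^n (Quotient.1-• L E.1#)

  module C = ConjugateSum QL.const-hom QE.const-hom QL.X QE.X p″ pr w^p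
  open C using (pick)

  inclusion : Hom (Q.quotient m α Int-α) L
  inclusion = C.T.eval-hom m′ α Int-α
    (trans (L.^-assocʳ QL.X p m) (trans (cong (QL.X L.^_) (ℕP.*-comm p m)) QL.X^n))
    (Boundedness.Int-^ L QL.Int-X p)

  -- The coordinates of v(xᵖ). The entries of v reappear unchanged among them, which is why
  -- integrality can be pulled back along `inclusion`.
  spread : ∀ {k} → Vec R.Carrier k → Vec R.Carrier (k ℕ.* p)
  spread [] = []
  spread (c ∷ v) = (c ∷ Q.0̂ {suc p″}) Vec.++ spread v

  inclusion-spread : ∀ v → fun inclusion v ≡ spread v
  inclusion-spread v = trans (go v) (QL.eval-X (spread v))
    where
    module X = Evaluation QL.const-hom QL.X
    go : ∀ {k} (v : Vec R.Carrier k) → C.T.eval v ≡ X.eval (spread v)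
    go [] = refl
    go (c ∷ v) = trans (cong₂ (λ a b → a L.+ QL.X L.^ p L.* b) (sym (X.eval-∷0̂ c (suc p″))) (go v))
      (sym (X.eval-++ (c ∷ Q.0̂ {suc p″}) (spread v)))

  Int-spread⁻ : ∀ {k} (v : Vec R.Carrier k) → All R.Int (spread v) → All R.Int v
  Int-spread⁻ [] _ = []
  Int-spread⁻ (c ∷ v) (q ∷ qs) = q ∷ Int-spread⁻ v (AllP.++ʳ⁻ (Q.0̂ {suc p″}) qs)

  conjugate : ℕ → Hom L E
  conjugate k = C.F.eval-hom k _ α Int-α (C.conjugate-^ k m QL.X^n)
    (E.Int-* (Boundedness.Int-^ E QE.Int-X k) (Hom.hom-Int QE.const-hom QL.Int-X))

  module QE′ = Quotient L

  -- Since p ≥ 2, the elements 1 and w are different basis vectors of `E` over `L`, and the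
  -- coordinate of (1 - w) y at 1 is y itself.
  Int-e*⁻ : ∀ y → E.Int (C.e E.* fun QE.const-hom y) → L.Int y
  Int-e*⁻ y q = subst L.Int head≡y
    (head (subst E.Int (trans (C.e* (fun QE.const-hom y)) (cong (λ z → fun QE.const-hom y E.+ (E.- z)) (QE.X* (fun QE.const-hom y)))) q))
    where
    head : ∀ {k a} {v : Vec L.Carrier k} → All L.Int (a ∷ v) → L.Int a
    head (q ∷ _) = q
    head≡y : y L.* L.1# L.+ (L.- (L.1# L.* QE′.lastOr (y L.* L.0#) (y QE′.• QE′.0̂ {p″}))) ≡ y
    head≡y = begin
      y L.* L.1# L.+ (L.- (L.1# L.* QE′.lastOr (y L.* L.0#) (y QE′.• QE′.0̂ {p″})))
        ≡⟨ cong (λ z → y L.* L.1# L.+ (L.- (L.1# L.* z))) (trans (QE′.lastOr-• y L.0# (QE′.0̂ {p″})) (cong (y L.*_) (QE′.lastOr-0 {p″}))) ⟩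
      y L.* L.1# L.+ (L.- (L.1# L.* (y L.* L.0#)))
        ≡⟨ cong₂ (λ a b → a L.+ (L.- b)) (L.*-identityʳ y) (trans (L.*-identityˡ _) (L.zeroʳ y)) ⟩
      y L.+ (L.- L.0#)
        ≡⟨ trans (cong₂ L._+_ refl L.-0#≈0#) (L.+-identityʳ y) ⟩
      y ∎

  Int-inclusion⁻ : ∀ v → L.Int (fun inclusion v) → A.Int v
  Int-inclusion⁻ v q = Int-spread⁻ v (subst (All R.Int) (inclusion-spread v) q)

  pick-Bounded : ∀ v → Boundedness.Bounded L v → Boundedness.Bounded (Q.quotient m α Int-α) (pick m v)
  pick-Bounded v bv = proj₁ powers , λ j → Int-inclusion⁻ (A.ι (fromℤ (+ suc (proj₁ powers))) A.* pick m v A.^ j) (proj₂ powers j)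
    where
    powers : Σ ℕ λ d → ∀ j → L.Int (fun inclusion (A.ι (fromℤ (+ suc d)) A.* pick m v A.^ j))
    powers = C.pick-power-Bounded inclusion QE.Int-X Int-e*⁻ m v (λ i → Hom.hom-Bounded (conjugate i) bv) (pick m v) refl

module _ (R : Algebra) (α : Algebra.Carrier R) (Int-α : Algebra.Int R α) where
  open Algebra R
  open Boundedness R using (Bounded; ν; ν-*)

  constantTerm : ∀ {k} → Vec Carrier k → Carrier
  constantTerm [] = 0#
  constantTerm (c ∷ _) = c

  -- n times the constant term is the trace of R[x]/(xⁿ - α) over R.
  trace-Bounded : ∀ {n} ps → ListAll.All Prime ps → n ≡ product ps → ∀ v →
    Boundedness.Bounded (Quotient.quotient R n α Int-α) v → Bounded (ν n * constantTerm v)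
  -- Here n = 1, and evaluation at x = α maps R[x]/(x - α) back to R.
  trace-Bounded [] _ refl (c ∷ []) bv = Boundedness.Bounded-* R (Boundedness.Int⇒Bounded R (Int-ι (+ 1)))
    (subst Bounded (trans (cong₂ _+_ refl (zeroʳ α)) (+-identityʳ c))
      (Hom.hom-Bounded (Evaluation.eval-hom (id-hom R) α 0 α Int-α (*-identityʳ α) Int-α) bv))
  trace-Bounded {n} (p ∷ ps) (pr ListAll.∷ prs) eq v bv =
    step p (product ps) pr refl (trans eq (ℕP.*-comm p (product ps))) (productOfPrimes≥1 prs) v bv
    where
    step : ∀ p m → Prime p → m ≡ product ps → n ≡ m ℕ.* p → 1 ℕ.≤ m → ∀ v →
      Boundedness.Bounded (Quotient.quotient R n α Int-α) v → Bounded (ν n * constantTerm v)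
    step 0 _ pr = λ _ _ _ _ _ → ⊥-elim (ℕ.NonZero.nonZero (prime⇒nonZero pr))
    step 1 _ pr = λ _ _ _ _ _ → ⊥-elim (ℕ.NonTrivial.nonTrivial (prime⇒nonTrivial pr))
    -- The trace lowers the exponent from m p to m and multiplies the constant term by p; the
    -- remaining primes contribute the factor m.
    step (suc (suc p″)) (suc m′) pr m≡ refl _ v@(c ∷ _) bv = subst Bounded
      (trans (sym (*-assoc _ _ c)) (cong (_* c) (sym (ν-* (suc m′) (suc (suc p″))))))
      (trace-Bounded ps prs m≡ (PrimeTrace.C.pick R m′ p″ α Int-α pr (suc m′) v)
        (PrimeTrace.pick-Bounded R m′ p″ α Int-α pr v bv))

-- Integer relations between vectors in ℤⁿ

fromℤ-0 : fromℤ (+ 0) ≡ 0ℚ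
fromℤ-0 = fromℤ-/1 (+ 0)

module Spans where
  open Algebra rationals using (Int)
  open Quotient rationals

  data Span {n} (v : ℕ → Vec ℚ n) : ℕ → Vec ℚ n → Set where
    [] : Span v 0 0̂
    extend : ∀ {m x} → Span v m x → (c : ℤ) → Span v (suc m) (x ⊕ fromℤ c • v m)

  fromℤ-+-• : ∀ {n} c d (v : Vec ℚ n) → fromℤ (c ℤ.+ d) • v ≡ fromℤ c • v ⊕ fromℤ d • v
  fromℤ-+-• c d v = trans (cong (_• v) (fromℤ-+ c d)) (+-• (fromℤ c) (fromℤ d) v)

  fromℤ-*-• : ∀ {n} c d (v : Vec ℚ n) → fromℤ (c ℤ.* d) • v ≡ fromℤ c • (fromℤ d • v)
  fromℤ-*-• c d v = trans (cong (_• v) (fromℤ-* c d)) (*-• (fromℤ c) (fromℤ d) v)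

  module _ {n} {v : ℕ → Vec ℚ n} where

    span-⊕ : ∀ {m x y} → Span v m x → Span v m y → Span v m (x ⊕ y)
    span-⊕ [] [] = subst (Span v 0) (sym (⊕-identityˡ 0̂)) []
    span-⊕ (extend {m} {x} s c) (extend {x = y} t d) = subst (Span v (suc m))
      (trans (cong ((x ⊕ y) ⊕_) (fromℤ-+-• c d (v m))) (⊕-interchange x y _ _))
      (extend (span-⊕ s t) (c ℤ.+ d))

    span-• : ∀ {m x} d → Span v m x → Span v m (fromℤ d • x)
    span-• d [] = subst (Span v 0) (sym (•-0 (fromℤ d))) []
    span-• d (extend {m} {x} s c) = subst (Span v (suc m))
      (trans (cong (fromℤ d • x ⊕_) (fromℤ-*-• d c (v m))) (sym (•-⊕ (fromℤ d) x _)))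
      (extend (span-• d s) (d ℤ.* c))

    span-0 : ∀ m → Span v m 0̂
    span-suc : ∀ {m x} → Span v m x → Span v (suc m) x

    span-0 zero = []
    span-0 (suc m) = span-suc (span-0 m)

    span-suc {m} {x} s = subst (Span v (suc m))
      (trans (cong (x ⊕_) (trans (cong (_• v m) fromℤ-0) (0-• (v m)))) (⊕-identityʳ x))
      (extend s (+ 0))

    span-+ : ∀ {m x} k → Span v m x → Span v (m ℕ.+ k) x
    span-+ {m} {x} zero s = subst (λ j → Span v j x) (sym (ℕP.+-identityʳ m)) s
    span-+ {m} {x} (suc k) s = subst (λ j → Span v j x) (sym (ℕP.+-suc m k)) (span-suc (span-+ k s))

    span-self : ∀ m → Span v (suc m) (v m)
    span-self m = subst (Span v (suc m))
      (trans (⊕-identityˡ _) (trans (cong (_• v m) (fromℤ-/1 (+ 1))) (1-• (v m))))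
      (extend (span-0 m) (+ 1))

    span-sub : ∀ {m x y} q → Span v m x → Span v m y → Span v m (x ⊕ fromℤ (ℤ.- q) • y)
    span-sub q s t = span-⊕ s (span-• (ℤ.- q) t)

  sub-add : ∀ {n} q (x y : Vec ℚ n) → (x ⊕ fromℤ (ℤ.- q) • y) ⊕ fromℤ q • y ≡ x
  sub-add q x y = trans (⊕-assoc x _ _) (trans (cong (x ⊕_)
    (trans (sym (fromℤ-+-• (ℤ.- q) q y)) (trans (cong (_• y) (trans (cong fromℤ (ℤP.+-inverseˡ q)) fromℤ-0)) (0-• y))))
    (⊕-identityʳ x))

  -- Subtracting multiples of b clears the leading coordinates from index M on, so a relation
  -- between the tails `v′` becomes a relation between the v. Only the k + 1 vectors that occur in
  -- this relation have to be cleared.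
  module Lift {n} (v : ℕ → Vec ℚ (suc n)) (v′ : ℕ → Vec ℚ n) (M : ℕ) (b : Vec ℚ (suc n)) (b∈ : Span v M b)
              (q : ℕ → ℤ) (k : ℕ) (reduce : ∀ i → i ℕ.< suc k → v (M ℕ.+ i) ⊕ fromℤ (ℤ.- q i) • b ≡ 0ℚ ∷ v′ i) where

    reduced∈ : ∀ i → i ℕ.< suc k → Span v (suc (M ℕ.+ i)) (0ℚ ∷ v′ i)
    reduced∈ i i≤k = subst (Span v _) (reduce i i≤k) (span-sub (q i) (span-self (M ℕ.+ i)) (span-suc (span-+ i b∈)))

    lift : ∀ {j y} → j ℕ.≤ k → Span v′ j y → Span v (M ℕ.+ j) (0ℚ ∷ y)
    lift _ [] = span-0 (M ℕ.+ 0)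
    lift j<k (extend {j} {y} s c) = subst (λ l → Span v l (0ℚ ∷ (y ⊕ fromℤ c • v′ j))) (sym (ℕP.+-suc M j))
      (subst (Span v (suc (M ℕ.+ j))) (cong (_∷ (y ⊕ fromℤ c • v′ j)) (trans (ℚP.+-identityˡ _) (ℚP.*-zeroʳ (fromℤ c))))
        (span-⊕ (span-suc (lift (ℕP.<⇒≤ j<k) s)) (span-• c (reduced∈ j (ℕP.m<n⇒m<1+n j<k)))))

    dependent : Span v′ k (v′ k) → Span v (M ℕ.+ k) (v (M ℕ.+ k))
    dependent s = subst (Span v (M ℕ.+ k))
      (trans (cong (_⊕ fromℤ (q k) • b) (sym (reduce k (ℕP.n<1+n k)))) (sub-add (q k) _ b))
      (span-⊕ (lift ℕP.≤-refl s) (span-• (q k) (span-+ k b∈)))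

  -- A constructive form of the statement that ℤⁿ is Noetherian.
  dependent : ∀ n (v : ℕ → Vec ℚ n) → (∀ i → All Int (v i)) → Σ ℕ λ m → Span v m (v m)
  dependent zero v _ = 0 , subst (Span v 0) (sym (empty (v 0))) []
    where
    empty : ∀ (x : Vec ℚ 0) → x ≡ []
    empty [] = refl
  dependent (suc n) v int = start (dependent n (λ i → Vec.tail (v i)) (λ i → tails (int i)))
    where
    heads : ∀ {x : Vec ℚ (suc n)} → All Int x → Int (Vec.head x)
    heads (p ∷ _) = p

    tails : ∀ {x : Vec ℚ (suc n)} → All Int x → All Int (Vec.tail x)
    tails (_ ∷ ps) = ps

    u : ℕ → ℤ
    u i = proj₁ (heads (int i))

    η : ∀ i → v i ≡ fromℤ (u i) ∷ Vec.tail (v i)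
    η i = go (v i) (int i)
      where
      go : ∀ x (p : All Int x) → x ≡ fromℤ (proj₁ (heads p)) ∷ Vec.tail x
      go (_ ∷ _) ((c , refl) ∷ _) = refl

    -- As long as some later leading coordinate is not a multiple of g, the remainder replaces g.
    descend : ∀ M g .{{_ : ℤ.NonZero g}} b → All Int b → Span v M (fromℤ g ∷ b) → Acc ℕ._<_ ℤ.∣ g ∣ → Σ ℕ λ m → Span v m (v m)
    descend M g b int-b b∈ (acc rec) = go (dependent n v′ int′)
      where
      q : ℕ → ℤ
      q i = u (M ℕ.+ i) ℤDM./ g

      r : ℕ → ℕ
      r i = u (M ℕ.+ i) ℤDM.% g

      v′ : ℕ → Vec ℚ n
      v′ i = Vec.tail (v (M ℕ.+ i)) ⊕ fromℤ (ℤ.- q i) • b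

      int′ : ∀ i → All Int (v′ i)
      int′ i = Int-⊕ (tails (int (M ℕ.+ i))) (Int-• (ℤ.- q i , refl) int-b)

      u-qg : ∀ i → u (M ℕ.+ i) ℤ.+ (ℤ.- q i) ℤ.* g ≡ + r i
      u-qg i = begin
        u (M ℕ.+ i) ℤ.+ (ℤ.- q i) ℤ.* g
          ≡⟨ cong₂ ℤ._+_ (ℤDM.a≡a%n+[a/n]*n (u (M ℕ.+ i)) g) (sym (ℤP.neg-distribˡ-* (q i) g)) ⟩
        + r i ℤ.+ q i ℤ.* g ℤ.+ (ℤ.- (q i ℤ.* g))
          ≡⟨ ℤP.+-assoc (+ r i) (q i ℤ.* g) (ℤ.- (q i ℤ.* g)) ⟩
        + r i ℤ.+ (q i ℤ.* g ℤ.+ (ℤ.- (q i ℤ.* g)))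
          ≡⟨ cong (λ z → + r i ℤ.+ z) (ℤP.+-inverseʳ (q i ℤ.* g)) ⟩
        + r i ℤ.+ + 0
          ≡⟨ ℤP.+-identityʳ _ ⟩
        + r i ∎

      remainder : ∀ i → v (M ℕ.+ i) ⊕ fromℤ (ℤ.- q i) • (fromℤ g ∷ b) ≡ fromℤ (+ r i) ∷ v′ i
      remainder i = trans (cong (_⊕ fromℤ (ℤ.- q i) • (fromℤ g ∷ b)) (η (M ℕ.+ i)))
        (cong (_∷ v′ i) (trans (cong (fromℤ (u (M ℕ.+ i)) ℚ.+_) (sym (fromℤ-* _ g)))
          (trans (sym (fromℤ-+ (u (M ℕ.+ i)) _)) (cong fromℤ (u-qg i)))))

      go : Σ ℕ (λ k → Span v′ k (v′ k)) → Σ ℕ λ m → Span v m (v m)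
      -- The relation between the tails is known before any remainder is inspected. It involves only
      -- k + 1 vectors, which makes the search for a nonzero remainder finite and hence decidable.
      go (k , s) with ℕP.anyUpTo? (λ i → ¬? (r i ℕ.≟ 0)) (suc k)
      ... | yes (i , _ , r≢0) = descend (suc (M ℕ.+ i)) (+ r i) {{ℕ.≢-nonZero r≢0}} (v′ i) (int′ i)
        (subst (Span v _) (remainder i) (span-sub (q i) (span-self (M ℕ.+ i)) (span-suc (span-+ i b∈))))
        (rec (ℤDM.n%d<d (u (M ℕ.+ i)) g))
      ... | no r≡0 = M ℕ.+ k , Lift.dependent v v′ M (fromℤ g ∷ b) b∈ q k
        (λ i i≤k → trans (remainder i) (cong (_∷ v′ i) (trans
          (cong (λ z → fromℤ (+ z)) (decidable-stable (r i ℕ.≟ 0) λ r≢0 → r≡0 (i , i≤k , r≢0))) fromℤ-0))) s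

    start : Σ ℕ (λ k → Span (λ i → Vec.tail (v i)) k (Vec.tail (v k))) → Σ ℕ λ m → Span v m (v m)
    start (k , s) with ℕP.anyUpTo? (λ i → ¬? (u i ℤ.≟ + 0)) (suc k)
    ... | yes (i , _ , u≢0) = descend (suc i) (u i) {{ℤ.≢-nonZero u≢0}} (Vec.tail (v i)) (tails (int i))
      (subst (Span v (suc i)) (η i) (span-self i)) (<-wellFounded _)
    -- The k + 1 relevant leading coordinates all vanish already, so the relation lifts with b = 0.
    ... | no u≡0 = k , Lift.dependent v (λ i → Vec.tail (v i)) 0 0̂ [] (λ _ → + 0) k
      (λ i i≤k → trans (cong (v i ⊕_) (•-0 (fromℤ (ℤ.- + 0)))) (trans (⊕-identityʳ (v i)) (trans (η i) (cong (_∷ Vec.tail (v i))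
        (trans (cong fromℤ (decidable-stable (u i ℤ.≟ + 0) λ u≢0 → u≡0 (i , i≤k , u≢0))) fromℤ-0))))) s

-- Number fields: algebraic integers are the bounded elements

numberField : ℕ → ℤ → Algebra
numberField n a = Quotient.quotient rationals n (fromℤ a) (a , refl)

rationals-Clearable : Boundedness.Clearable rationals
rationals-Clearable h@(ℚ.mkℚ c d _) = d , c , ℚP.toℚᵘ-injective (ℚᵘP.≃-trans
  (ℚP.toℚᵘ-homo-* (fromℤ (+ suc d)) h)
  (ℚᵘP.≃-trans (ℚᵘP.*-cong (toℚᵘ-fromℤ (+ suc d)) (ℚᵘP.≃-refl {ℚᵘ.mkℚᵘ c d}))
    (ℚᵘP.≃-trans cross (ℚᵘP.≃-sym (toℚᵘ-fromℤ c)))))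
  where
  cross : ℚᵘ.mkℚᵘ (+ suc d) 0 ℚᵘ.* ℚᵘ.mkℚᵘ c d ℚᵘ.≃ ℚᵘ.mkℚᵘ c 0
  cross = ℚᵘ.*≡* (trans (ℤP.*-identityʳ _) (trans (ℤP.*-comm (+ suc d) c)
    (cong (λ z → c ℤ.* (+ suc z)) (sym (ℕP.+-identityʳ d)))))

module AlgebraicIntegers (n′ : ℕ) (a : ℤ) where
  private
    n = suc n′
    module Q = Quotient rationals
  K = numberField n a
  open Algebra K
  open Boundedness K

  mulL-act : ∀ {k} (u : Vec ℚ k) v → mulL n a (Vec.toList u) v ≡ Q.act n (fromℤ a) u v
  mulL-act [] v = refl
  mulL-act (c ∷ u) v = cong₂ Q._⊕_ refl (trans (cong (mulθ′ a) (mulL-act u v)) (mulθ-θ (Q.act n (fromℤ a) u v)))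
    where
    push-init : ∀ {k} c (v : Vec ℚ (suc k)) → c ∷ Vec.init v ≡ Q.push c v
    push-init c (x ∷ []) = refl
    push-init c (x ∷ v@(_ ∷ _)) = cong (c ∷_) (push-init x v)
    lastOr-last : ∀ {k} c (v : Vec ℚ (suc k)) → Vec.last v ≡ Q.lastOr c v
    lastOr-last c (x ∷ []) = refl
    lastOr-last c (x ∷ v@(_ ∷ _)) = lastOr-last x v
    mulθ-θ : ∀ (v : Vec ℚ n) → mulθ′ a v ≡ Q.θ n (fromℤ a) v
    mulθ-θ v = trans (push-init _ v) (cong (λ z → Q.push z v) (cong₂ ℚ._*_ (sym (fromℤ-/1 a)) (lastOr-last 0ℚ v)))

  sumL : List ℤ → Carrier → Carrier
  sumL [] v = 0#
  sumL (b ∷ bs) v = ι (fromℤ b) + v * sumL bs v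

  monicEval-∷ : ∀ b bs v → monicEval n a (b ∷ bs) v ≡ ι (fromℤ b) + v * monicEval n a bs v
  monicEval-∷ b bs v = cong₂ Q._⊕_ (cong (Q._• 1#) (sym (fromℤ-/1 b))) (mulL-act v (monicEval n a bs v))

  monicEval-sumL : ∀ bs v → monicEval n a bs v ≡ sumL bs v + v ^ length bs
  monicEval-sumL [] v = sym (+-identityˡ 1#)
  monicEval-sumL (b ∷ bs) v = trans (monicEval-∷ b bs v)
    (trans (cong (λ z → ι (fromℤ b) + v * z) (monicEval-sumL bs v)) (distrib (ι (fromℤ b)) v (sumL bs v) (v ^ length bs)))
    where
    distrib : ∀ b v s t → b + v * (s + t) ≡ (b + v * s) + v * t
    distrib b v s t = trans (cong₂ _+_ refl (distribˡ v s t)) (sym (+-assoc b (v * s) (v * t)))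

  numberField-Clearable : Clearable
  numberField-Clearable = QuotientProperties.quotient-Clearable rationals n (fromℤ a) (a , refl) rationals-Clearable

  IsAlgInt⇒Bounded : ∀ v → IsAlgInt n a v → Bounded v
  IsAlgInt⇒Bounded v (bs , eq) = monic⇒Bounded numberField-Clearable v (negated bs) (Int-negated bs)
    (+-cancelʳ (sumL bs v) _ _ (trans (trans (+-comm _ _) (trans (sym (monicEval-sumL bs v)) eq)) (sym (cancel bs))))
    where
    negated : ∀ bs → Vec Carrier (length bs)
    negated [] = []
    negated (b ∷ bs) = ι (fromℤ (ℤ.- b)) ∷ negated bs
    Int-negated : ∀ bs → All Int (negated bs)
    Int-negated [] = []
    Int-negated (b ∷ bs) = Int-ι (ℤ.- b) ∷ Int-negated bs
    ι-neg : ∀ b → ι (fromℤ (ℤ.- b)) + ι (fromℤ b) ≡ 0#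
    ι-neg b = trans (sym (ι-+ (fromℤ (ℤ.- b)) (fromℤ b)))
      (trans (cong ι (trans (sym (fromℤ-+ (ℤ.- b) b)) (trans (cong fromℤ (ℤP.+-inverseˡ b)) fromℤ-0))) ι-0)
    cancel : ∀ bs → poly (negated bs) v + sumL bs v ≡ 0#
    cancel [] = +-identityˡ 0#
    cancel (b ∷ bs) = begin
      (ι (fromℤ (ℤ.- b)) + v * poly (negated bs) v) + (ι (fromℤ b) + v * sumL bs v)
        ≡⟨ Q.⊕-interchange (ι (fromℤ (ℤ.- b))) (v * poly (negated bs) v) (ι (fromℤ b)) (v * sumL bs v) ⟩
      (ι (fromℤ (ℤ.- b)) + ι (fromℤ b)) + (v * poly (negated bs) v + v * sumL bs v)
        ≡⟨ cong₂ _+_ (ι-neg b) (trans (sym (distribˡ v _ _)) (trans (cong (v *_) (cancel bs)) (zeroʳ v))) ⟩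
      0# + 0#
        ≡⟨ +-identityˡ 0# ⟩
      0# ∎

  sumL-∷ʳ : ∀ bs c v → sumL (bs List.∷ʳ c) v ≡ sumL bs v + ι (fromℤ c) * v ^ length bs
  sumL-∷ʳ [] c v = trans (trans (cong₂ _+_ refl (zeroʳ v)) (+-identityʳ _))
    (sym (trans (+-identityˡ _) (*-identityʳ (ι (fromℤ c)))))
  sumL-∷ʳ (b ∷ bs) c v = trans (cong (λ z → ι (fromℤ b) + v * z) (sumL-∷ʳ bs c v)) (rearrange (ι (fromℤ b)) v (sumL bs v) (ι (fromℤ c)) (v ^ length bs))
    where
    rearrange : ∀ b v s c t → b + v * (s + c * t) ≡ (b + v * s) + c * (v * t)
    rearrange b v s c t = begin
      b + v * (s + c * t)         ≡⟨ cong₂ _+_ refl (distribˡ v s (c * t)) ⟩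
      b + (v * s + v * (c * t))   ≡⟨ sym (+-assoc b (v * s) _) ⟩
      (b + v * s) + v * (c * t)   ≡⟨ cong₂ _+_ refl (trans (sym (*-assoc v c t)) (trans (cong (_* t) (*-comm v c)) (*-assoc c v t))) ⟩
      (b + v * s) + c * (v * t)   ∎

  -- The vectors (d + 1) vᵐ lie in ℤⁿ, so one of them is an integer combination of the earlier ones;
  -- cancelling d + 1 leaves a monic equation.
  Bounded⇒IsAlgInt : ∀ v → Bounded v → IsAlgInt n a v
  Bounded⇒IsAlgInt v (d , p) = go (dependent n s p)
    where
    open Spans
    D = fromℤ (+ suc d)
    s : ℕ → Carrier
    s m = ν (suc d) * v ^ m

    relation : ∀ {m x} → Span s m x → Σ (List ℤ) λ bs → length bs ≡ m × x ≡ ν (suc d) * sumL bs v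
    relation [] = [] , refl , sym (zeroʳ (ν (suc d)))
    relation (extend {x = x} t c) with relation t
    ... | bs , refl , eq = bs List.∷ʳ c , trans (ListP.length-++ bs) (ℕP.+-comm _ 1) , (begin
      x + fromℤ c Q.• (ν (suc d) * v ^ length bs)
        ≡⟨ cong₂ _+_ eq (sym (QuotientProperties.•-one rationals n (fromℤ a) (a , refl) (fromℤ c) (ν (suc d) * v ^ length bs))) ⟩
      ν (suc d) * sumL bs v + ι (fromℤ c) * (ν (suc d) * v ^ length bs)
        ≡⟨ factor (ν (suc d)) (sumL bs v) (ι (fromℤ c)) (v ^ length bs) ⟩
      ν (suc d) * (sumL bs v + ι (fromℤ c) * v ^ length bs)
        ≡⟨ cong (ν (suc d) *_) (sym (sumL-∷ʳ bs c v)) ⟩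
      ν (suc d) * sumL (bs List.∷ʳ c) v ∎)
      where
      factor : ∀ n s c t → n * s + c * (n * t) ≡ n * (s + c * t)
      factor n s c t = sym (trans (distribˡ n s (c * t)) (cong₂ _+_ refl
        (trans (sym (*-assoc n c t)) (trans (cong (_* t) (*-comm n c)) (*-assoc c n t)))))

    go : _ → IsAlgInt n a v
    -- The factor -1 moves the combination to the side of vᵐ, as `monicEval` requires.
    go (m , t) with relation (span-• (ℤ.- + 1) t)
    ... | bs , refl , eq = bs , trans (monicEval-sumL bs v) (ν-cancel d (begin
      ν (suc d) * (sumL bs v + v ^ length bs)
        ≡⟨ distribˡ (ν (suc d)) (sumL bs v) (v ^ length bs) ⟩
      ν (suc d) * sumL bs v + s (length bs)
        ≡⟨ cong₂ _+_ (sym eq) (sym (trans (cong (Q._• s (length bs)) (fromℤ-/1 (+ 1))) (Q.1-• (s (length bs))))) ⟩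
      fromℤ (ℤ.- + 1) Q.• s (length bs) + fromℤ (+ 1) Q.• s (length bs)
        ≡⟨ sym (fromℤ-+-• (ℤ.- + 1) (+ 1) (s (length bs))) ⟩
      fromℤ (+ 0) Q.• s (length bs)
        ≡⟨ trans (cong (Q._• s (length bs)) fromℤ-0) (trans (Q.0-• (s (length bs))) (sym (zeroʳ (ν (suc d))))) ⟩
      ν (suc d) * 0# ∎))

-- Divisibility of binomial coefficients

prime∣⇒∣rad : ∀ {n p} .{{_ : ℕ.NonZero n}} → Prime p → p ∣ n → p ∣ rad n
prime∣⇒∣rad {n} {p} pr p∣n = ∈⇒∣product
  (∈-filter⁺ (λ p → prime? p ×-dec (p ∣.∣? n)) (∈-upTo⁺ (s≤s (∣.∣⇒≤ p∣n))) (pr , p∣n))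

prime-divisor : ∀ n → n ≢ 0 → n ≢ 1 → Σ ℕ λ p → Prime p × p ∣ n
prime-divisor n n≢0 n≢1 = go (PrimeFactorisation.factors f) (PrimeFactorisation.isFactorisation f) (PrimeFactorisation.factorsPrime f)
  where
  f = factorise n {{ℕ.≢-nonZero n≢0}}
  go : ∀ ps → n ≡ product ps → ListAll.All Prime ps → Σ ℕ λ p → Prime p × p ∣ n
  go [] eq _ = ⊥-elim (n≢1 eq)
  go (p ∷ ps) eq (pr ListAll.∷ _) = p , pr , divides (product ps) (trans eq (ℕP.*-comm p _))

coprime-by-primes : ∀ {m n} → m ≢ 0 → (∀ {p} → Prime p → p ∣ m → p ∣ n → ⊥) → Coprime m n
coprime-by-primes {m} {n} m≢0 f {d} (d∣m , d∣n) with d ℕ.≟ 1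
... | yes d≡1 = d≡1
... | no d≢1 with prime-divisor d (λ { refl → m≢0 (∣.0∣⇒≡0 d∣m) }) d≢1
... | p , pr , p∣d = ⊥-elim (f pr (∣.∣-trans p∣d d∣m) (∣.∣-trans p∣d d∣n))

coprime-^ʳ : ∀ {m n} k → Coprime m n → Coprime m (n ℕ.^ k)
coprime-^ʳ zero c = Coprimality.sym (Coprimality.1-coprimeTo _)
coprime-^ʳ {m} {n} (suc k) c {d} (d∣m , d∣n^) = coprime-^ʳ k c
  (d∣m , coprime-divisor (λ { (e∣d , e∣n) → c (∣.∣-trans e∣d d∣m , e∣n) }) d∣n^)

prime∣^⇒∣ : ∀ {p m} → Prime p → ∀ k → p ∣ m ℕ.^ k → p ∣ m
prime∣^⇒∣ pr zero p∣1 = ⊥-elim (¬prime∣1 pr p∣1)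
  where
  ¬prime∣1 : ∀ {p} → Prime p → p ∣ 1 → ⊥
  ¬prime∣1 pr p∣1 with ∣.∣1⇒≡1 p∣1
  ¬prime∣1 () _ | refl
prime∣^⇒∣ {p} {m} pr (suc k) p∣ with euclidsLemma m (m ℕ.^ k) pr p∣
... | inj₁ p∣m = p∣m
... | inj₂ p∣m^k = prime∣^⇒∣ pr k p∣m^k

*-^ : ∀ m n k → (m ℕ.* n) ℕ.^ k ≡ m ℕ.^ k ℕ.* n ℕ.^ k
*-^ m n zero = refl
*-^ m n (suc k) = trans (cong (m ℕ.* n ℕ.*_) (*-^ m n k))
  (solve 4 (λ m n s t → m :* n :* (s :* t) := m :* s :* (n :* t)) refl m n (m ℕ.^ k) (n ℕ.^ k))
  where open +-*-Solver

^-monoʳ-∣ : ∀ r {i j} → i ≤ j → r ℕ.^ i ∣ r ℕ.^ j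
^-monoʳ-∣ r {zero} _ = ∣.1∣ _
^-monoʳ-∣ r (s≤s p) = ∣.*-monoʳ-∣ r (^-monoʳ-∣ r p)

absorption : ∀ n k → suc k ℕ.* (suc n C suc k) ≡ suc n ℕ.* (n C k)
absorption zero zero = refl
absorption zero (suc k) = trans (cong (suc (suc k) ℕ.*_) (k>n⇒nCk≡0 {1} {suc (suc k)} (s≤s (s≤s z≤n))))
  (trans (ℕP.*-zeroʳ (suc (suc k))) (sym (trans (ℕP.*-identityˡ _) (k>n⇒nCk≡0 {0} {suc k} (s≤s z≤n)))))
absorption (suc n) zero = begin
  1 ℕ.* (suc (suc n) C 1)                       ≡⟨ ℕP.*-identityˡ _ ⟩
  suc (suc n) C 1                               ≡⟨ sym (nCk+nC[k+1]≡[n+1]C[k+1] (suc n) 0) ⟩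
  1 ℕ.+ suc n C 1                               ≡⟨ cong suc (trans (sym (ℕP.*-identityˡ _)) (absorption n zero)) ⟩
  1 ℕ.+ suc n ℕ.* 1                             ∎
absorption (suc n) (suc k) = begin
  suc (suc k) ℕ.* (suc (suc n) C suc (suc k))
    ≡⟨ cong (suc (suc k) ℕ.*_) (sym (nCk+nC[k+1]≡[n+1]C[k+1] (suc n) (suc k))) ⟩
  suc (suc k) ℕ.* (suc n C suc k ℕ.+ suc n C suc (suc k))
    ≡⟨ ℕP.*-distribˡ-+ (suc (suc k)) (suc n C suc k) _ ⟩
  (suc n C suc k ℕ.+ suc k ℕ.* (suc n C suc k)) ℕ.+ suc (suc k) ℕ.* (suc n C suc (suc k))
    ≡⟨ cong₂ (λ a b → (suc n C suc k ℕ.+ a) ℕ.+ b) (absorption n k) (absorption n (suc k)) ⟩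
  (suc n C suc k ℕ.+ suc n ℕ.* (n C k)) ℕ.+ suc n ℕ.* (n C suc k)
    ≡⟨ trans (ℕP.+-assoc (suc n C suc k) _ _) (cong (suc n C suc k ℕ.+_) (sym (ℕP.*-distribˡ-+ (suc n) (n C k) _))) ⟩
  suc n C suc k ℕ.+ suc n ℕ.* (n C k ℕ.+ n C suc k)
    ≡⟨ cong (λ z → suc n C suc k ℕ.+ suc n ℕ.* z) (nCk+nC[k+1]≡[n+1]C[k+1] n k) ⟩
  suc (suc n) ℕ.* (suc n C suc k) ∎

Split : ℕ → ℕ → Set
Split r i = Σ ℕ λ s → Σ ℕ λ t → suc i ≡ s ℕ.* t × s ∣ r ℕ.^ i × Coprime t r

-- The part of i + 1 that is not prime to r divides rⁱ, since v_q(i + 1) ≤ i for every prime q.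
split : ∀ r i → Acc _<_ i → Split r i
split r i (acc rec) with gcd (suc i) r ℕ.≟ 1
... | yes g≡1 = 1 , suc i , sym (ℕP.*-identityˡ _) , ∣.1∣ _ , gcd≡1⇒coprime g≡1
... | no g≢1 = peel (gcd (suc i) r) g≢1 (gcd[m,n]∣m (suc i) r) (gcd[m,n]∣n (suc i) r)
  where
  peel : ∀ g → g ≢ 1 → g ∣ suc i → g ∣ r → Split r i
  peel zero _ (divides q eq) _ with trans eq (ℕP.*-zeroʳ q)
  ... | ()
  peel (suc zero) g≢1 _ _ = ⊥-elim (g≢1 refl)
  -- From i + 1 = (j + 1) g and g ≥ 2 follows j < i; so beyond the rʲ that s uses there is one more
  -- power of r available for g.
  peel g@(suc (suc _)) _ (divides (suc j) eq) g∣r with split r j (rec j<i)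
    where
    j<i : j < i
    j<i = ℕP.≤-pred (subst (suc j <_) (sym eq) (ℕP.m<m*n (suc j) g (s≤s (s≤s z≤n))))
  ... | s , t , eq′ , s∣r^j , c = g ℕ.* s , t
    , trans eq (trans (ℕP.*-comm (suc j) g) (trans (cong (g ℕ.*_) eq′) (sym (ℕP.*-assoc g s t))))
    , ∣.∣-trans (∣.*-pres-∣ g∣r s∣r^j) (^-monoʳ-∣ r (ℕP.≤-pred (subst (suc j <_) (sym eq) (ℕP.m<m*n (suc j) g (s≤s (s≤s z≤n))))))
    , c

n∣nC[i+1]*rad^i : ∀ n i .{{_ : ℕ.NonZero n}} → n ∣ (n C suc i) ℕ.* rad n ℕ.^ i
n∣nC[i+1]*rad^i n@(suc n′) i with split (rad n) i (<-wellFounded i)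
... | s , t , eq , s∣r^i , c = ∣.∣-trans (coprime-divisor n⊥t n∣tsC)
    (subst (s ℕ.* (n C suc i) ∣_) (ℕP.*-comm (rad n ℕ.^ i) _) (∣.*-monoˡ-∣ (n C suc i) s∣r^i))
  where
  n⊥t : Coprime n t
  n⊥t = coprime-by-primes (λ ()) λ pr p∣n p∣t → prime⊥1 pr (c (p∣t , prime∣⇒∣rad pr p∣n))
    where
    prime⊥1 : ∀ {p} → Prime p → p ≡ 1 → ⊥
    prime⊥1 () refl
  n∣tsC : n ∣ t ℕ.* (s ℕ.* (n C suc i))
  n∣tsC = divides (n′ C i) (begin
    t ℕ.* (s ℕ.* (n C suc i)) ≡⟨ trans (sym (ℕP.*-assoc t s _)) (cong (ℕ._* (n C suc i)) (trans (ℕP.*-comm t s) (sym eq))) ⟩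
    suc i ℕ.* (n C suc i)     ≡⟨ absorption n′ i ⟩
    n ℕ.* (n′ C i)            ≡⟨ ℕP.*-comm n _ ⟩
    (n′ C i) ℕ.* n            ∎)

-- Bounded rational numbers are integers

n<b^n : ∀ b n → n < suc (suc b) ℕ.^ n
n<b^n b zero = s≤s z≤n
n<b^n b (suc n) = ℕP.≤-trans (ℕP.+-mono-≤ (ℕP.≤-trans (s≤s z≤n) (n<b^n b n)) (n<b^n b n))
  (ℕP.+-monoʳ-≤ (suc (suc b) ℕ.^ n) (ℕP.m≤m+n _ _))

module _ where
  open Boundedness rationals
  private module A = Algebra rationals

  fromℤ-^ : ∀ c m → fromℤ (c ℤ.^ m) ≡ fromℤ c A.^ m
  fromℤ-^ c zero = fromℤ-/1 (+ 1)
  fromℤ-^ c (suc m) = trans (fromℤ-* c (c ℤ.^ m)) (cong (fromℤ c ℚ.*_) (fromℤ-^ c m))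

  ∣^∣ : ∀ c m → ℤ.∣ c ℤ.^ m ∣ ≡ ℤ.∣ c ∣ ℕ.^ m
  ∣^∣ c zero = refl
  ∣^∣ c (suc m) = trans (ℤP.abs-* c (c ℤ.^ m)) (cong (ℤ.∣ c ∣ ℕ.*_) (∣^∣ c m))

  -- If D clears all powers of c / q, in lowest terms with q ≥ 2, then the power with exponent D
  -- itself gives qᴰ ∣ D, contradicting D < qᴰ.
  rational-Bounded⇒Int : ∀ ρ → Bounded ρ → A.Int ρ
  rational-Bounded⇒Int ρ@(ℚ.mkℚ c zero _) _ = c , trans (sym (trans (cong (ℚ._* ρ) (fromℤ-/1 (+ 1))) (ℚP.*-identityˡ ρ))) (proj₂ (proj₂ (rationals-Clearable ρ)))
  rational-Bounded⇒Int ρ@(ℚ.mkℚ c (suc b) cop) (d , p) = ⊥-elim (ℕP.<-irrefl refl (ℕP.<-≤-trans (n<b^n b (suc d)) (∣.∣⇒≤ q^D∣D)))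
    where
    q = suc (suc b)
    N = proj₁ (p (suc d))
    integral : + suc d ℤ.* c ℤ.^ suc d ≡ N ℤ.* (+ q) ℤ.^ suc d
    integral = fromℤ-injective (begin
      fromℤ (+ suc d ℤ.* c ℤ.^ suc d)
        ≡⟨ trans (fromℤ-* (+ suc d) (c ℤ.^ suc d)) (cong (ν (suc d) ℚ.*_) (fromℤ-^ c (suc d))) ⟩
      ν (suc d) A.* fromℤ c A.^ suc d
        ≡⟨ cong (λ z → ν (suc d) A.* z A.^ suc d) (sym (proj₂ (proj₂ (rationals-Clearable ρ)))) ⟩
      ν (suc d) A.* (ν q A.* ρ) A.^ suc d
        ≡⟨ cong (ν (suc d) A.*_) (A.^-distrib-* (ν q) ρ (suc d)) ⟩
      ν (suc d) A.* (ν q A.^ suc d A.* ρ A.^ suc d)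
        ≡⟨ trans (cong (ν (suc d) A.*_) (A.*-comm (ν q A.^ suc d) (ρ A.^ suc d))) (sym (A.*-assoc (ν (suc d)) (ρ A.^ suc d) (ν q A.^ suc d))) ⟩
      ν (suc d) A.* ρ A.^ suc d A.* ν q A.^ suc d
        ≡⟨ cong₂ ℚ._*_ (proj₂ (p (suc d))) (sym (fromℤ-^ (+ q) (suc d))) ⟩
      fromℤ N ℚ.* fromℤ ((+ q) ℤ.^ suc d)
        ≡⟨ sym (fromℤ-* N _) ⟩
      fromℤ (N ℤ.* (+ q) ℤ.^ suc d) ∎)
    q^D∣D : q ℕ.^ suc d ∣ suc d
    q^D∣D = coprime-divisor {q ℕ.^ suc d} {ℤ.∣ c ∣ ℕ.^ suc d}
      (coprime-^ʳ (suc d) (Coprimality.sym (coprime-^ʳ (suc d) (Coprimality.recompute cop))))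
      (divides ℤ.∣ N ∣ (begin
        ℤ.∣ c ∣ ℕ.^ suc d ℕ.* suc d          ≡⟨ ℕP.*-comm _ (suc d) ⟩
        suc d ℕ.* ℤ.∣ c ∣ ℕ.^ suc d          ≡⟨ cong (suc d ℕ.*_) (sym (∣^∣ c (suc d))) ⟩
        suc d ℕ.* ℤ.∣ c ℤ.^ suc d ∣          ≡⟨ sym (ℤP.abs-* (+ suc d) (c ℤ.^ suc d)) ⟩
        ℤ.∣ + suc d ℤ.* c ℤ.^ suc d ∣        ≡⟨ cong ℤ.∣_∣ integral ⟩
        ℤ.∣ N ℤ.* (+ q) ℤ.^ suc d ∣          ≡⟨ trans (ℤP.abs-* N _) (cong (ℤ.∣ N ∣ ℕ.*_) (∣^∣ (+ q) (suc d))) ⟩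
        ℤ.∣ N ∣ ℕ.* q ℕ.^ suc d              ∎))

-- Integrality of z = (yⁿ - xⁿ) / (n (y - x))

module DifferenceQuotient (A : Algebra) where
  open Algebra A
  open Boundedness A

  -- (yⁿ - xⁿ) / (y - x)
  H : ℕ → Carrier → Carrier → Carrier
  H zero x y = 0#
  H (suc k) x y = y ^ k + x * H k x y

  H-difference : ∀ k x c → (x + c) ^ k ≡ x ^ k + c * H k x (x + c)
  H-difference zero x c = sym (trans (cong₂ _+_ refl (zeroʳ c)) (+-identityʳ 1#))
  H-difference (suc k) x c = begin
    (x + c) * (x + c) ^ k
      ≡⟨ distribʳ ((x + c) ^ k) x c ⟩
    x * (x + c) ^ k + c * (x + c) ^ k
      ≡⟨ cong (λ z → x * z + c * (x + c) ^ k) (H-difference k x c) ⟩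
    x * (x ^ k + c * h) + c * (x + c) ^ k
      ≡⟨ solve 5 (λ x c s h t → x :* (s :+ c :* h) :+ c :* t := x :* s :+ c :* (t :+ x :* h)) refl x c (x ^ k) h ((x + c) ^ k) ⟩
    x ^ suc k + c * ((x + c) ^ k + x * h) ∎
    where h = H k x (x + c)

  -- `H k` is homogeneous of degree k - 1; the extra factor z on the left avoids subtraction in the
  -- exponent.
  H-homogeneous : ∀ k z x y → H k (z * x) (z * y) * z ≡ z ^ k * H k x y
  H-homogeneous zero z x y = trans (zeroˡ z) (sym (zeroʳ 1#))
  H-homogeneous (suc k) z x y = begin
    ((z * y) ^ k + z * x * H k (z * x) (z * y)) * z
      ≡⟨ cong (λ t → (t + z * x * H k (z * x) (z * y)) * z) (^-distrib-* z y k) ⟩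
    (z ^ k * y ^ k + z * x * H k (z * x) (z * y)) * z
      ≡⟨ solve 5 (λ s t z x h → (s :* t :+ z :* x :* h) :* z := z :* s :* t :+ z :* x :* (h :* z)) refl (z ^ k) (y ^ k) z x (H k (z * x) (z * y)) ⟩
    z * z ^ k * y ^ k + z * x * (H k (z * x) (z * y) * z)
      ≡⟨ cong (λ h → z * z ^ k * y ^ k + z * x * h) (H-homogeneous k z x y) ⟩
    z * z ^ k * y ^ k + z * x * (z ^ k * H k x y)
      ≡⟨ solve 5 (λ s t z x h → z :* s :* t :+ z :* x :* (s :* h) := z :* s :* (t :+ x :* h)) refl (z ^ k) (y ^ k) z x (H k x y) ⟩
    z ^ suc k * H (suc k) x y ∎

  -- Both n (y - x) z and n c are equal to yⁿ - xⁿ, and only the integer n has to be cancelled.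
  difference-shift : ∀ n′ x y z p p′ c → ν (suc n′) * z ≡ H (suc n′) x y → x ^ suc n′ ≡ ι p → y ^ suc n′ ≡ ι p′ →
    ι p′ ≡ ι p + ν (suc n′) * ι c → y * z ≡ x * z + ι c
  difference-shift n′ x y z p p′ c nz x^n y^n p′≡ = begin
    y * z            ≡⟨ cong (_* z) (sym x+d) ⟩
    (x + d) * z      ≡⟨ distribʳ z x d ⟩
    x * z + d * z    ≡⟨ cong (λ w → x * z + w) dz≡c ⟩
    x * z + ι c ∎
    where
    n = suc n′
    d = y + - x
    x+d : x + d ≡ y
    x+d = trans (+-comm x d) (trans (+-assoc y (- x) x) (trans (cong₂ _+_ refl (-‿inverseˡ x)) (+-identityʳ y)))
    dz≡c : d * z ≡ ι c
    dz≡c = ν-cancel n′ (+-cancelʳ (x ^ n) _ _ (begin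
      ν n * (d * z) + x ^ n           ≡⟨ solve 4 (λ a d z s → a :* (d :* z) :+ s := s :+ d :* (a :* z)) refl (ν n) d z (x ^ n) ⟩
      x ^ n + d * (ν n * z)           ≡⟨ cong (λ w → x ^ n + d * w) (trans nz (cong (H n x) (sym x+d))) ⟩
      x ^ n + d * H n x (x + d)       ≡⟨ sym (H-difference n x d) ⟩
      (x + d) ^ n                     ≡⟨ trans (cong (_^ n) x+d) (trans y^n p′≡) ⟩
      ι p + ν n * ι c                 ≡⟨ trans (cong (_+ ν n * ι c) (sym x^n)) (+-comm _ _) ⟩
      ν n * ι c + x ^ n ∎))

  module Horner (u : Carrier) where

    -- ∑_{i < n} f i · u^(n-1-i)
    horner : ℕ → (ℕ → Carrier) → Carrier
    horner zero f = 0#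
    horner (suc n) f = u * horner n f + f n

    horner-cong : ∀ n {f g} → (∀ i → f i ≡ g i) → horner n f ≡ horner n g
    horner-cong zero eq = refl
    horner-cong (suc n) eq = cong₂ (λ a b → u * a + b) (horner-cong n eq) (eq n)

    horner-+ : ∀ n f g → horner n (λ i → f i + g i) ≡ horner n f + horner n g
    horner-+ zero f g = sym (+-identityˡ 0#)
    horner-+ (suc n) f g = trans (cong (λ z → u * z + (f n + g n)) (horner-+ n f g))
      (solve 5 (λ u a b c d → u :* (a :+ b) :+ (c :+ d) := (u :* a :+ c) :+ (u :* b :+ d)) refl u (horner n f) (horner n g) (f n) (g n))

    horner-* : ∀ n c f → horner n (λ i → c * f i) ≡ c * horner n f
    horner-* zero c f = sym (zeroʳ c)
    horner-* (suc n) c f = trans (cong (λ z → u * z + c * f n) (horner-* n c f))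
      (solve 4 (λ u c a b → u :* (c :* a) :+ c :* b := c :* (u :* a :+ b)) refl u c (horner n f) (f n))

    horner-front : ∀ n f → horner (suc n) f ≡ u ^ n * f 0 + horner n (λ i → f (suc i))
    horner-front zero f = solve 2 (λ u f → u :* con 0 :+ f := con 1 :* f :+ con 0) refl u (f 0)
    horner-front (suc n) f = trans (cong (λ z → u * z + f (suc n)) (horner-front n f))
      (solve 5 (λ u s a h b → u :* (s :* a :+ h) :+ b := u :* s :* a :+ (u :* h :+ b)) refl u (u ^ n) (f 0) (horner n (λ i → f (suc i))) (f (suc n)))

    -- The expansion of ((u + c)ⁿ - uⁿ) / c. It is obtained from Pascal's rule rather than by
    -- division, since c may be zero.
    H-binomial : ∀ n c → H n u (u + c) ≡ horner n (λ i → ν (n C suc i) * c ^ i)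
    H-binomial zero c = refl
    H-binomial (suc n) c = begin
      (u + c) ^ n + u * H n u (u + c)
        ≡⟨ cong₂ (λ a b → a + u * b) power (H-binomial n c) ⟩
      horner (suc n) (λ i → ν (n C i) * c ^ i) + u * horner n (λ i → ν (n C suc i) * c ^ i)
        ≡⟨ cong (λ z → horner (suc n) (λ i → ν (n C i) * c ^ i) + z) (sym top) ⟩
      horner (suc n) (λ i → ν (n C i) * c ^ i) + horner (suc n) (λ i → ν (n C suc i) * c ^ i)
        ≡⟨ sym (horner-+ (suc n) _ _) ⟩
      horner (suc n) (λ i → ν (n C i) * c ^ i + ν (n C suc i) * c ^ i)
        ≡⟨ horner-cong (suc n) (λ i → trans (sym (distribʳ (c ^ i) (ν (n C i)) (ν (n C suc i))))
             (cong (_* c ^ i) (trans (sym (ν-+ (n C i) (n C suc i))) (cong ν (nCk+nC[k+1]≡[n+1]C[k+1] n i))))) ⟩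
      horner (suc n) (λ i → ν (suc n C suc i) * c ^ i) ∎
      where
      -- The additional term has coefficient C(n,n+1) = 0; it makes the two sums equally long, so
      -- that they can be added termwise.
      top : horner (suc n) (λ i → ν (n C suc i) * c ^ i) ≡ u * horner n (λ i → ν (n C suc i) * c ^ i)
      top = trans (cong (λ z → u * horner n (λ i → ν (n C suc i) * c ^ i) + z * c ^ n)
        (trans (cong ν (k>n⇒nCk≡0 {n} {suc n} (ℕP.n<1+n n))) ν-0))
        (trans (cong₂ _+_ refl (zeroˡ (c ^ n))) (+-identityʳ _))
      power : (u + c) ^ n ≡ horner (suc n) (λ i → ν (n C i) * c ^ i)
      power = begin
        (u + c) ^ n
          ≡⟨ H-difference n u c ⟩
        u ^ n + c * H n u (u + c)
          ≡⟨ cong₂ _+_ (sym (trans (cong (u ^ n *_) (trans (*-identityʳ _) ν-1)) (*-identityʳ _))) (trans (cong (c *_) (H-binomial n c)) (sym (horner-* n c _))) ⟩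
        u ^ n * (ν 1 * 1#) + horner n (λ i → c * (ν (n C suc i) * c ^ i))
          ≡⟨ cong₂ _+_ refl (horner-cong n (λ i → solve 3 (λ c b t → c :* (b :* t) := b :* (c :* t)) refl c (ν (n C suc i)) (c ^ i))) ⟩
        u ^ n * (ν 1 * 1#) + horner n (λ i → ν (n C suc i) * c ^ suc i)
          ≡⟨ sym (horner-front n _) ⟩
        horner (suc n) (λ i → ν (n C i) * c ^ i) ∎

  open Horner

  -- Every power of z x brings as many factors x as z, so the sum is a polynomial in z whose
  -- coefficients absorb the powers of x.
  horner-poly : ∀ z x n f → Int x → (∀ i → Int (f i)) →
    Σ (Vec Carrier n) λ cs → All Int cs × horner (z * x) n f ≡ poly cs z
  horner-poly z x zero f _ _ = [] , [] , refl
  horner-poly z x (suc n) f Int-x Int-f with horner-poly z x n f Int-x Int-f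
  ... | cs , Int-cs , eq = f n ∷ map (x *_) cs , Int-f n ∷ Quotient.Int-• A Int-x Int-cs , (begin
    z * x * horner (z * x) n f + f n  ≡⟨ cong (λ t → z * x * t + f n) eq ⟩
    z * x * poly cs z + f n           ≡⟨ solve 4 (λ z x p f → z :* x :* p :+ f := f :+ z :* (x :* p)) refl z x (poly cs z) (f n) ⟩
    f n + z * (x * poly cs z)         ≡⟨ cong (λ t → f n + z * t) (sym (poly-scale cs)) ⟩
    f n + z * poly (map (x *_) cs) z  ∎)
    where
    poly-scale : ∀ {k} (cs : Vec Carrier k) → poly (map (x *_) cs) z ≡ x * poly cs z
    poly-scale [] = sym (zeroʳ x)
    poly-scale (c ∷ cs) = trans (cong (λ t → x * c + z * t) (poly-scale cs))
      (solve 4 (λ x c z p → x :* c :+ z :* (x :* p) := x :* (c :+ z :* p)) refl x c z (poly cs z))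

  -- z = H n x y / n satisfies n zⁿ⁺¹ = z H n (z x) (z y), and z y = z x + r t is a translate
  -- of z x by an integer.
  quotient-Bounded : Clearable → ∀ n′ x y z t → let n = suc n′ in Int x →
    ν n * z ≡ H n x y → z * y ≡ z * x + ι (fromℤ (+ rad n ℤ.* t)) → Bounded z
  quotient-Bounded clear n′ x y z t Int-x nz zy = monic⇒Bounded clear z (0# ∷ proj₁ coeffs)
    (Int-0 ∷ proj₁ (proj₂ coeffs))
    (trans equation (trans (cong (z *_) (proj₂ (proj₂ coeffs))) (sym (+-identityˡ _))))
    where
    n = suc n′
    c = ι (fromℤ (+ rad n ℤ.* t))
    -- The integer C(n,i+1) rⁱ / n: this is where the factor r of the modulus is spent.
    B : ℕ → ℕ
    B i = ∣.quotient (n∣nC[i+1]*rad^i n i)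
    f : ℕ → Carrier
    f i = ν (B i) * ι (fromℤ t) ^ i
    coeffs = horner-poly z x n f Int-x (λ i → Int-* (Int-ι (+ B i)) (Int-^ (Int-ι t) i))

    ν-^ : ∀ r i → ν (r ℕ.^ i) ≡ ν r ^ i
    ν-^ r zero = ν-1
    ν-^ r (suc i) = trans (ν-* r (r ℕ.^ i)) (cong (ν r *_) (ν-^ r i))

    coefficient : ∀ i → ν (n C suc i) * c ^ i ≡ ν n * f i
    coefficient i = begin
      ν (n C suc i) * c ^ i
        ≡⟨ cong (λ w → ν (n C suc i) * w ^ i) (trans (cong ι (fromℤ-* (+ rad n) t)) (ι-* _ _)) ⟩
      ν (n C suc i) * (ν (rad n) * ι (fromℤ t)) ^ i
        ≡⟨ cong (ν (n C suc i) *_) (^-distrib-* (ν (rad n)) (ι (fromℤ t)) i) ⟩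
      ν (n C suc i) * (ν (rad n) ^ i * ι (fromℤ t) ^ i)
        ≡⟨ sym (*-assoc (ν (n C suc i)) (ν (rad n) ^ i) (ι (fromℤ t) ^ i)) ⟩
      ν (n C suc i) * ν (rad n) ^ i * ι (fromℤ t) ^ i
        ≡⟨ cong (_* ι (fromℤ t) ^ i) (trans (cong (ν (n C suc i) *_) (sym (ν-^ (rad n) i))) (sym (ν-* (n C suc i) (rad n ℕ.^ i)))) ⟩
      ν ((n C suc i) ℕ.* rad n ℕ.^ i) * ι (fromℤ t) ^ i
        ≡⟨ cong (λ k → ν k * ι (fromℤ t) ^ i) (trans (_∣_.equality (n∣nC[i+1]*rad^i n i)) (ℕP.*-comm (B i) n)) ⟩
      ν (n ℕ.* B i) * ι (fromℤ t) ^ i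
        ≡⟨ trans (cong (_* ι (fromℤ t) ^ i) (ν-* n (B i))) (*-assoc (ν n) (ν (B i)) (ι (fromℤ t) ^ i)) ⟩
      ν n * f i ∎

    equation : z ^ suc n ≡ z * horner (z * x) n f
    equation = ν-cancel n′ (begin
      ν n * (z * z ^ n)              ≡⟨ solve 3 (λ a z s → a :* (z :* s) := s :* (a :* z)) refl (ν n) z (z ^ n) ⟩
      z ^ n * (ν n * z)              ≡⟨ cong (z ^ n *_) nz ⟩
      z ^ n * H n x y                ≡⟨ sym (H-homogeneous n z x y) ⟩
      H n (z * x) (z * y) * z        ≡⟨ cong (λ w → H n (z * x) w * z) zy ⟩
      H n (z * x) (z * x + c) * z    ≡⟨ cong (_* z) (H-binomial (z * x) n c) ⟩
      horner (z * x) n (λ i → ν (n C suc i) * c ^ i) * z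
                                     ≡⟨ cong (_* z) (trans (horner-cong (z * x) n coefficient) (horner-* (z * x) n (ν n) f)) ⟩
      ν n * horner (z * x) n f * z   ≡⟨ solve 3 (λ a z s → a :* s :* z := a :* (z :* s)) refl (ν n) z (horner (z * x) n f) ⟩
      ν n * (z * horner (z * x) n f) ∎)

-- Interpolation, and transfer of f(θ) to a f(θ′)

-- T plays the role of (1/n) times the trace of R[x]/(xⁿ - a) over R; the identity computed here is
-- Lagrange interpolation of f(y) from the values of f at the roots of xⁿ - a.
module Interpolation {R L : Algebra} (κ : Hom R L) (T : Algebra.Carrier L → Algebra.Carrier R) (n′ : ℕ) where
  private
    n = suc n′
    module L = Algebra L
  open Algebra R
  open Boundedness R using (ν)

  module _
    (T-+ : ∀ u v → T (u L.+ v) ≡ T u + T v)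
    (T-* : ∀ c v → T (fun κ c L.* v) ≡ c * T v)
    (x z : L.Carrier) (y : Carrier) (p p′ c : ℚ)
    (T-x : ∀ j → suc j < n → T (x L.^ suc j) ≡ 0#)
    (T-1 : T L.1# ≡ 1#)
    (T-z : ν n * T z ≡ y ^ n′)
    (yz : fun κ y L.* z ≡ x L.* z L.+ L.ι c)
    (y^n : y ^ n ≡ ι p′)
    (p′≡ : ι p′ ≡ ι p + ν n * ι c)
    where

    module X = Evaluation (ι-hom L) x
    module Y = Evaluation (ι-hom R) y

    T-ι : ∀ q v → T (L.ι q L.* v) ≡ ι q * T v
    T-ι q v = trans (cong (λ w → T (w L.* v)) (sym (Hom.hom-ι κ q))) (T-* (ι q) v)

    T-shift : ∀ v → T (v L.* (x L.* z)) + ι c * T v ≡ y * T (v L.* z)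
    T-shift v = begin
      T (v L.* (x L.* z)) + ι c * T v
        ≡⟨ cong₂ _+_ refl (sym (T-ι c v)) ⟩
      T (v L.* (x L.* z)) + T (L.ι c L.* v)
        ≡⟨ sym (T-+ _ _) ⟩
      T (v L.* (x L.* z) L.+ L.ι c L.* v)
        ≡⟨ cong T (L.solve 3 (λ v w c → v L.:* w L.:+ c L.:* v L.:= v L.:* (w L.:+ c)) refl v (x L.* z) (L.ι c)) ⟩
      T (v L.* (x L.* z L.+ L.ι c))
        ≡⟨ cong (λ w → T (v L.* w)) (sym yz) ⟩
      T (v L.* (fun κ y L.* z))
        ≡⟨ cong T (L.solve 3 (λ v y z → v L.:* (y L.:* z) L.:= y L.:* (v L.:* z)) refl v (fun κ y) z) ⟩
      T (fun κ y L.* (v L.* z))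
        ≡⟨ T-* y _ ⟩
      y * T (v L.* z) ∎

    -- From n T(z) = yⁿ⁻¹ the relation y z = x z + c leads to n T(x z) = yⁿ - n c = p. Afterwards
    -- T(xⁱ) = 0 removes the term with c, and each further factor x turns into a factor y. The
    -- values at xⁱ z are thus yⁿ⁻¹, p, p y, ...; using x z instead of z skips the exceptional first
    -- one.
    T-monomial : ∀ i → i < n → ν n * T (x L.^ i L.* (x L.* z)) ≡ ι p * y ^ i
    T-monomial zero _ = +-cancelʳ (ν n * ι c) _ _ (begin
      ν n * T (L.1# L.* (x L.* z)) + ν n * ι c
        ≡⟨ cong (λ w → ν n * T (L.1# L.* (x L.* z)) + ν n * w) (sym (trans (cong (ι c *_) T-1) (*-identityʳ _))) ⟩
      ν n * T (L.1# L.* (x L.* z)) + ν n * (ι c * T L.1#)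
        ≡⟨ trans (sym (distribˡ _ _ _)) (cong (ν n *_) (T-shift L.1#)) ⟩
      ν n * (y * T (L.1# L.* z))
        ≡⟨ trans (cong (λ w → ν n * (y * T w)) (L.*-identityˡ z)) (solve 3 (λ a y t → a :* (y :* t) := y :* (a :* t)) refl (ν n) y (T z)) ⟩
      y * (ν n * T z)
        ≡⟨ cong (y *_) T-z ⟩
      y ^ n
        ≡⟨ trans y^n p′≡ ⟩
      ι p + ν n * ι c
        ≡⟨ cong (_+ ν n * ι c) (sym (*-identityʳ (ι p))) ⟩
      ι p * 1# + ν n * ι c ∎)
    T-monomial (suc i) i<n = begin
      ν n * T (x L.^ suc i L.* (x L.* z))
        ≡⟨ cong (ν n *_) (sym (trans (cong₂ _+_ refl (trans (cong (ι c *_) (T-x i i<n)) (zeroʳ (ι c)))) (+-identityʳ _))) ⟩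
      ν n * (T (x L.^ suc i L.* (x L.* z)) + ι c * T (x L.^ suc i))
        ≡⟨ cong (ν n *_) (T-shift (x L.^ suc i)) ⟩
      ν n * (y * T (x L.^ suc i L.* z))
        ≡⟨ solve 3 (λ a y t → a :* (y :* t) := y :* (a :* t)) refl (ν n) y _ ⟩
      y * (ν n * T (x L.^ suc i L.* z))
        ≡⟨ cong (λ w → y * (ν n * T w)) (L.solve 3 (λ x s z → x L.:* s L.:* z L.:= s L.:* (x L.:* z)) refl x (x L.^ i) z) ⟩
      y * (ν n * T (x L.^ i L.* (x L.* z)))
        ≡⟨ cong (y *_) (T-monomial i (ℕP.<-trans (ℕP.n<1+n i) i<n)) ⟩
      y * (ι p * y ^ i)
        ≡⟨ solve 3 (λ y p s → y :* (p :* s) := p :* (y :* s)) refl y (ι p) (y ^ i) ⟩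
      ι p * y ^ suc i ∎

    interpolate : ∀ i {k} (f : Vec ℚ k) → i ℕ.+ k ≡ n →
      ν n * T (x L.^ i L.* X.eval f L.* (x L.* z)) ≡ ι p * (y ^ i * Y.eval f)
    interpolate i [] _ = begin
      ν n * T (x L.^ i L.* L.0# L.* (x L.* z))
        ≡⟨ cong (λ w → ν n * T w) (L.solve 3 (λ s w u → s L.:* L.con 0 L.:* w L.:= L.con 0 L.:* u) refl (x L.^ i) (x L.* z) L.1#) ⟩
      ν n * T (L.0# L.* L.1#)
        ≡⟨ cong (λ w → ν n * T (w L.* L.1#)) (sym L.ι-0) ⟩
      ν n * T (L.ι 0ℚ L.* L.1#)
        ≡⟨ cong (ν n *_) (trans (T-ι 0ℚ L.1#) (cong (_* T L.1#) ι-0)) ⟩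
      ν n * (0# * T L.1#)
        ≡⟨ solve 4 (λ a t p s → a :* (con 0 :* t) := p :* (s :* con 0)) refl (ν n) (T L.1#) (ι p) (y ^ i) ⟩
      ι p * (y ^ i * 0#) ∎
    interpolate i {suc k} (h ∷ f) eq = begin
      ν n * T (x L.^ i L.* (L.ι h L.+ x L.* X.eval f) L.* (x L.* z))
        ≡⟨ cong (λ w → ν n * T w) (L.solve 5 (λ s h x e w → s L.:* (h L.:+ x L.:* e) L.:* w L.:= h L.:* (s L.:* w) L.:+ x L.:* s L.:* e L.:* w)
             refl (x L.^ i) (L.ι h) x (X.eval f) (x L.* z)) ⟩
      ν n * T (L.ι h L.* (x L.^ i L.* (x L.* z)) L.+ x L.^ suc i L.* X.eval f L.* (x L.* z))
        ≡⟨ cong (ν n *_) (trans (T-+ _ _) (cong₂ _+_ (T-ι h _) refl)) ⟩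
      ν n * (ι h * T (x L.^ i L.* (x L.* z)) + T (x L.^ suc i L.* X.eval f L.* (x L.* z)))
        ≡⟨ solve 4 (λ a h s t → a :* (h :* s :+ t) := h :* (a :* s) :+ a :* t) refl (ν n) (ι h) _ _ ⟩
      ι h * (ν n * T (x L.^ i L.* (x L.* z))) + ν n * T (x L.^ suc i L.* X.eval f L.* (x L.* z))
        ≡⟨ cong₂ (λ a b → ι h * a + b) (T-monomial i (subst (i <_) eq (ℕP.m<m+n i (s≤s z≤n)))) (interpolate (suc i) f (trans (sym (ℕP.+-suc i k)) eq)) ⟩
      ι h * (ι p * y ^ i) + ι p * (y * y ^ i * Y.eval f)
        ≡⟨ solve 5 (λ h p s y e → h :* (p :* s) :+ p :* (y :* s :* e) := p :* (s :* (h :+ y :* e))) refl (ι h) (ι p) (y ^ i) y (Y.eval f) ⟩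
      ι p * (y ^ i * (ι h + y * Y.eval f)) ∎

-- `L` is ℚ(θ) ⊗ ℚ(θ′) as a free module over `K′`; x stands for θ and y for θ′.
module Transfer (n′ : ℕ) (a a′ t : ℤ) (a′≡ : a′ ≡ a ℤ.+ + suc n′ ℤ.* (+ rad (suc n′) ℤ.* t)) where
  private
    n = suc n′
    K = numberField n a
    K′ = numberField n a′
    module K′ = Algebra K′
    module B′ = Boundedness K′
    module Q′ = Quotient K′
    module QK′ = QuotientProperties rationals n (fromℤ a′) (a′ , refl)
    module QL = QuotientProperties K′ n (K′.ι (fromℤ a)) (K′.Int-ι a)
    module QQ = Quotient rationals
    L = QL.L
    module L = Algebra L
    module BL = Boundedness L
    open DifferenceQuotient L using (H; difference-shift; quotient-Bounded)
    c = + rad n ℤ.* t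
    x = QL.X
    y = QK′.X
    κ = QL.const-hom

  -- For k = n, the coordinates of (yⁿ - xⁿ) / (y - x) = ∑ yⁿ⁻¹⁻ⁱ xⁱ in the basis 1, x, ..., xⁿ⁻¹.
  -- The first of them gives `T-z`.
  reverse-powers : ∀ k → Vec K′.Carrier k
  reverse-powers zero = []
  reverse-powers (suc k) = y K′.^ k ∷ reverse-powers k

  z : L.Carrier
  z = BL.ν⁻¹ n′ L.* reverse-powers n

  module EX = Evaluation κ x

  reverse-powers-H : ∀ k → EX.eval (reverse-powers k) ≡ H k x (fun κ y)
  reverse-powers-H zero = refl
  reverse-powers-H (suc k) = cong₂ (λ u v → u L.+ x L.* v) (Hom.hom-^ κ y k) (reverse-powers-H k)

  nz≡ : BL.ν n L.* z ≡ reverse-powers n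
  nz≡ = trans (sym (L.*-assoc (BL.ν n) (BL.ν⁻¹ n′) (reverse-powers n)))
    (trans (cong (L._* reverse-powers n) (trans (L.*-comm (BL.ν n) (BL.ν⁻¹ n′)) (BL.ν⁻¹-inverse n′)))
      (L.*-identityˡ (reverse-powers n)))

  nz : BL.ν n L.* z ≡ H n x (fun κ y)
  nz = trans nz≡ (trans (sym (QL.eval-X (reverse-powers n))) (reverse-powers-H n))

  a′-split : ∀ (A : Algebra) → let open Algebra A in ι (fromℤ a′) ≡ ι (fromℤ a) + Boundedness.ν A n * ι (fromℤ c)
  a′-split A = trans (cong (λ b → ι (fromℤ b)) a′≡) (trans (cong ι (fromℤ-+ a (+ n ℤ.* c)))
    (trans (ι-+ _ _) (cong (λ w → ι (fromℤ a) + w) (trans (cong ι (fromℤ-* (+ n) c)) (ι-* _ _)))))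
    where open Algebra A

  y^n : y K′.^ n ≡ K′.ι (fromℤ a′)
  y^n = QK′.X^n

  x^n : x L.^ n ≡ L.ι (fromℤ a)
  x^n = QL.X^n

  yz : fun κ y L.* z ≡ x L.* z L.+ L.ι (fromℤ c)
  yz = difference-shift n′ x (fun κ y) z (fromℤ a) (fromℤ a′) (fromℤ c) nz x^n
    (trans (sym (Hom.hom-^ κ y n)) (trans (cong (fun κ) y^n) (Hom.hom-ι κ (fromℤ a′)))) (a′-split L)

  z-Bounded : BL.Bounded z
  z-Bounded = quotient-Bounded (QL.quotient-Clearable (AlgebraicIntegers.numberField-Clearable n′ a′)) n′ x (fun κ y) z t QL.Int-X nz
    (trans (L.*-comm z (fun κ y)) (trans yz (cong (L._+ L.ι (fromℤ c)) (L.*-comm x z))))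

  T : L.Carrier → K′.Carrier
  T = constantTerm K′ (K′.ι (fromℤ a)) (K′.Int-ι a)

  T-+ : ∀ u v → T (u L.+ v) ≡ T u K′.+ T v
  T-+ (_ ∷ _) (_ ∷ _) = refl

  T-* : ∀ k v → T (fun κ k L.* v) ≡ k K′.* T v
  T-* k v@(_ ∷ _) = cong T (QL.•-one k v)

  T-x : ∀ j → suc j < n → T (x L.^ suc j) ≡ K′.0#
  T-x j j<n = cong T (trans (sym (L.*-identityʳ (x L.^ suc j))) (trans (QL.X^* (suc j) L.1#) (Q′.θ^-one n (K′.ι (fromℤ a)) (suc j) j<n)))

  T-z : B′.ν n K′.* T z ≡ y K′.^ n′
  T-z = trans (sym (T-* (B′.ν n) z)) (cong T nz≡)

  module I = Interpolation κ T n′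
  module XE = Evaluation (ι-hom L) x
  module YE = Evaluation (ι-hom K′) y

  interpolation : ∀ f → B′.ν n K′.* T (XE.eval f L.* (x L.* z)) ≡ K′.ι (fromℤ a) K′.* f
  interpolation f = begin
    B′.ν n K′.* T (XE.eval f L.* (x L.* z))
      ≡⟨ cong (λ w → B′.ν n K′.* T (w L.* (x L.* z))) (sym (L.*-identityˡ (XE.eval f))) ⟩
    B′.ν n K′.* T (L.1# L.* XE.eval f L.* (x L.* z))
      ≡⟨ I.interpolate T-+ T-* x z y (fromℤ a) (fromℤ a′) (fromℤ c) T-x refl T-z yz y^n (a′-split K′) 0 f refl ⟩
    K′.ι (fromℤ a) K′.* (K′.1# K′.* YE.eval f)
      ≡⟨ cong (K′.ι (fromℤ a) K′.*_) (trans (K′.*-identityˡ (YE.eval f)) (y-eval f)) ⟩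
    K′.ι (fromℤ a) K′.* f ∎
    where
    y-eval : ∀ f → YE.eval f ≡ f
    y-eval f = trans (go f) (QK′.eval-X f)
      where
      go : ∀ {k} (f : Vec ℚ k) → YE.eval f ≡ Evaluation.eval QK′.const-hom y f
      go [] = refl
      go (h ∷ f) = cong (λ w → K′.ι h K′.+ y K′.* w) (go f)

  K→L : Hom K L
  K→L = XE.eval-hom n′ (fromℤ a) (a , refl) x^n QL.Int-X

  transfer : ∀ f → Boundedness.Bounded K f → B′.Bounded (K′.ι (fromℤ a) K′.* f)
  transfer f bf = subst B′.Bounded (interpolation f)
    (trace-Bounded K′ (K′.ι (fromℤ a)) (K′.Int-ι a) (PrimeFactorisation.factors fac) (PrimeFactorisation.factorsPrime fac)
      (PrimeFactorisation.isFactorisation fac) (XE.eval f L.* (x L.* z))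
      (BL.Bounded-* (Hom.hom-Bounded K→L bf) (BL.Bounded-* (BL.Int⇒Bounded QL.Int-X) z-Bounded)))
    where
    fac : PrimeFactorisation n
    fac = factorise n

-- Denominators prime to a

module BoundedDifferences (A : Algebra) where
  open Algebra A
  open Boundedness A

  Bounded-cancelʳ : ∀ {u v} → Bounded (u + v) → Bounded v → Bounded u
  Bounded-cancelʳ {u} {v} p q = subst Bounded
    (trans (cong₂ _+_ refl (-1*x≈-x v)) (trans (+-assoc u v (- v)) (trans (cong₂ _+_ refl (-‿inverseʳ v)) (+-identityʳ u))))
    (Bounded-+ p (Bounded-* (Int⇒Bounded Int--1) q))

  Bounded-ν* : ∀ {h} k → Bounded h → Bounded (ν k * h)
  Bounded-ν* k = Bounded-* (Int⇒Bounded (Int-ι (+ k)))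

  coprime-multiples-Bounded : ∀ {q r} f → Coprime q r → Bounded (ν q * f) → Bounded (ν r * f) → Bounded f
  coprime-multiples-Bounded {q} {r} f q⊥r bq br = go (coprime-Bézout q⊥r)
    where
    identity : ∀ x q y r → 1 ℕ.+ y ℕ.* r ≡ x ℕ.* q → ν x * (ν q * f) ≡ f + ν y * (ν r * f)
    identity x q y r eq = begin
      ν x * (ν q * f)        ≡⟨ trans (sym (*-assoc (ν x) (ν q) f)) (cong (_* f) (trans (sym (ν-* x q)) (cong ν (sym eq)))) ⟩
      ν (1 ℕ.+ y ℕ.* r) * f  ≡⟨ cong (_* f) (trans (ν-+ 1 (y ℕ.* r)) (cong₂ _+_ ν-1 (ν-* y r))) ⟩
      (1# + ν y * ν r) * f   ≡⟨ solve 3 (λ y r f → (con 1 :+ y :* r) :* f := f :+ y :* (r :* f)) refl (ν y) (ν r) f ⟩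
      f + ν y * (ν r * f)    ∎
    go : Bézout.Identity 1 q r → Bounded f
    go (Bézout.+- x y eq) = Bounded-cancelʳ (subst Bounded (identity x q y r eq) (Bounded-ν* x bq)) (Bounded-ν* y br)
    go (Bézout.-+ x y eq) = Bounded-cancelʳ (subst Bounded (identity y r x q eq) (Bounded-ν* y br)) (Bounded-ν* x bq)

  abs-multiple-Bounded : ∀ c f → Bounded (ι (fromℤ c) * f) → Bounded (ν ℤ.∣ c ∣ * f)
  abs-multiple-Bounded (+ k) f β = β
  abs-multiple-Bounded -[1+ k ] f β = subst Bounded
    (trans (sym (*-assoc (ι (fromℤ ℤ.-1ℤ)) (ι (fromℤ -[1+ k ])) f)) (cong (_* f)
      (trans (sym (ι-* _ _)) (cong ι (trans (sym (fromℤ-* ℤ.-1ℤ -[1+ k ])) (cong fromℤ (ℤP.-1*i≡-i -[1+ k ])))))))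
    (Bounded-* (Int⇒Bounded (Int-ι ℤ.-1ℤ)) β)

  private module ℚA = Algebra rationals

  leading-Bounded : ∀ n′ X a {e} h → X ^ suc n′ ≡ ι (fromℤ a) → Int X → Int (ι (fromℤ a) * e) →
    ∀ j k → j ℕ.+ k ≡ n′ → Bounded (X ^ j * (ι h + X * e)) → Bounded (ι (h ℚA.^ suc n′ ℚ.* fromℤ a ℚA.^ n′))
  leading-Bounded n′ X a {e} h X^n Int-X Int-ae j k j+k b = subst Bounded power (Bounded-^ leading (suc n′))
    where
    shifted : X ^ k * (X ^ j * (ι h + X * e)) ≡ ι h * X ^ n′ + ι (fromℤ a) * e
    shifted = begin
      X ^ k * (X ^ j * (ι h + X * e))
        ≡⟨ solve 5 (λ s t h x e → s :* (t :* (h :+ x :* e)) := h :* (t :* s) :+ x :* (t :* s) :* e) refl (X ^ k) (X ^ j) (ι h) X e ⟩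
      ι h * (X ^ j * X ^ k) + X * (X ^ j * X ^ k) * e
        ≡⟨ cong (λ w → ι h * w + X * w * e) (trans (sym (^-homo-* X j k)) (cong (X ^_) j+k)) ⟩
      ι h * X ^ n′ + X ^ suc n′ * e
        ≡⟨ cong (λ w → ι h * X ^ n′ + w * e) X^n ⟩
      ι h * X ^ n′ + ι (fromℤ a) * e ∎
    leading : Bounded (ι h * X ^ n′)
    leading = Bounded-cancelʳ (subst Bounded shifted (Bounded-* (Int⇒Bounded (Int-^ Int-X k)) b)) (Int⇒Bounded Int-ae)
    power : (ι h * X ^ n′) ^ suc n′ ≡ ι (h ℚA.^ suc n′ ℚ.* fromℤ a ℚA.^ n′)
    power = begin
      (ι h * X ^ n′) ^ suc n′              ≡⟨ ^-distrib-* (ι h) (X ^ n′) (suc n′) ⟩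
      ι h ^ suc n′ * (X ^ n′) ^ suc n′     ≡⟨ cong (ι h ^ suc n′ *_) (trans (^-assocʳ X n′ (suc n′)) (trans (cong (X ^_) (ℕP.*-comm n′ (suc n′))) (sym (^-assocʳ X (suc n′) n′)))) ⟩
      ι h ^ suc n′ * (X ^ suc n′) ^ n′     ≡⟨ cong (λ w → ι h ^ suc n′ * w ^ n′) X^n ⟩
      ι h ^ suc n′ * ι (fromℤ a) ^ n′      ≡⟨ sym (cong₂ _*_ (Hom.hom-^ (ι-hom A) h (suc n′)) (Hom.hom-^ (ι-hom A) (fromℤ a) n′)) ⟩
      ι (h ℚA.^ suc n′) * ι (fromℤ a ℚA.^ n′) ≡⟨ sym (ι-* _ _) ⟩
      ι (h ℚA.^ suc n′ ℚ.* fromℤ a ℚA.^ n′) ∎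

  tail-Bounded : ∀ X {e} h → Int X → Int (ι h) → ∀ j → Bounded (X ^ j * (ι h + X * e)) → Bounded (X ^ suc j * e)
  tail-Bounded X {e} h Int-X Int-h j b = Bounded-cancelʳ
    (subst Bounded (solve 4 (λ s h x e → s :* (h :+ x :* e) := x :* s :* e :+ s :* h) refl (X ^ j) (ι h) X e) b)
    (Int⇒Bounded (Int-* (Int-^ Int-X j) Int-h))

-- If p clears the denominators of an integral element, then for the lowest coefficient h not yet known
-- to be integral, multiplication by a power of X leaves h Xⁿ⁻¹ modulo ℤ[X], since p divides Xⁿ = a.
-- The n-th power of h Xⁿ⁻¹ is rational, hence an integer, and p divides a only once.
module Eisenstein (n′ : ℕ) (a : ℤ) (p′ : ℕ) (pr : Prime (suc p′)) (b : ℤ) (a≡ : a ≡ + suc p′ ℤ.* b) (p∤b : ¬ suc p′ ∣ ℤ.∣ b ∣) where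
  private
    n = suc n′
    p = suc p′
    K = numberField n a
    module K = Algebra K
    module ℚA = Algebra rationals
    module QK = QuotientProperties rationals n (fromℤ a) (a , refl)
    module QQ = Quotient rationals
    module BD = BoundedDifferences K
  open Boundedness K using (Bounded)

  ι-Bounded⁻ : ∀ q → Bounded (K.ι q) → Boundedness.Bounded rationals q
  ι-Bounded⁻ q (d , β) = d , λ m → head (subst K.Int (sym (trans (Hom.hom-* (ι-hom K) (fromℤ (+ suc d)) (q ℚA.^ m)) (cong (K.ι (fromℤ (+ suc d)) K.*_) (Hom.hom-^ (ι-hom K) q m)))) (β m))
    where
    head : ∀ {r} → K.Int (K.ι r) → ℚA.Int r
    head {r} (i ∷ _) = subst ℚA.Int (ℚP.*-identityʳ r) i

  -- Since a = p b, the power of a supplies pⁿ⁻¹, one factor short of the pⁿ on the right. The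
  -- missing p divides cⁿ bⁿ⁻¹, and it does not divide b.
  p∣-coefficient : ∀ c M → c ℤ.^ n ℤ.* a ℤ.^ n′ ≡ (+ p) ℤ.^ n ℤ.* M → p ∣ ℤ.∣ c ∣
  p∣-coefficient c M eq with euclidsLemma (ℤ.∣ c ∣ ℕ.^ n) (ℤ.∣ b ∣ ℕ.^ n′) pr (divides ℤ.∣ M ∣ (ℕP.*-cancelˡ-≡ _ _ (p ℕ.^ n′) {{ℕP.m^n≢0 p n′}} (begin
      p ℕ.^ n′ ℕ.* (ℤ.∣ c ∣ ℕ.^ n ℕ.* ℤ.∣ b ∣ ℕ.^ n′)
        ≡⟨ solve 3 (λ p c b → p :* (c :* b) := c :* (p :* b)) refl (p ℕ.^ n′) (ℤ.∣ c ∣ ℕ.^ n) (ℤ.∣ b ∣ ℕ.^ n′) ⟩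
      ℤ.∣ c ∣ ℕ.^ n ℕ.* (p ℕ.^ n′ ℕ.* ℤ.∣ b ∣ ℕ.^ n′)
        ≡⟨ cong (ℤ.∣ c ∣ ℕ.^ n ℕ.*_) (sym (trans (cong (ℕ._^ n′) (trans (cong ℤ.∣_∣ a≡) (ℤP.abs-* (+ p) b))) (*-^ p ℤ.∣ b ∣ n′))) ⟩
      ℤ.∣ c ∣ ℕ.^ n ℕ.* ℤ.∣ a ∣ ℕ.^ n′
        ≡⟨ sym (trans (ℤP.abs-* (c ℤ.^ n) (a ℤ.^ n′)) (cong₂ ℕ._*_ (∣^∣ c n) (∣^∣ a n′))) ⟩
      ℤ.∣ c ℤ.^ n ℤ.* a ℤ.^ n′ ∣
        ≡⟨ trans (cong ℤ.∣_∣ eq) (trans (ℤP.abs-* ((+ p) ℤ.^ n) M) (cong (ℕ._* ℤ.∣ M ∣) (∣^∣ (+ p) n))) ⟩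
      p ℕ.^ n ℕ.* ℤ.∣ M ∣
        ≡⟨ solve 3 (λ p s m → p :* s :* m := s :* (m :* p)) refl p (p ℕ.^ n′) ℤ.∣ M ∣ ⟩
      p ℕ.^ n′ ℕ.* (ℤ.∣ M ∣ ℕ.* p) ∎)))
    where open +-*-Solver
  ... | inj₁ p∣c^n = prime∣^⇒∣ pr n p∣c^n
  ... | inj₂ p∣b^n′ = ⊥-elim (p∤b (prime∣^⇒∣ pr n′ p∣b^n′))

  leading-Int : ∀ h → ℚA.Int (fromℤ (+ p) ℚ.* h) → Boundedness.Bounded rationals (h ℚA.^ n ℚ.* fromℤ a ℚA.^ n′) → ℚA.Int h
  leading-Int h (c , ph≡c) β with rational-Bounded⇒Int _ β
  ... | M , eq with ℤDS.∣ᵤ⇒∣ {+ p} {c} (p∣-coefficient c M (fromℤ-injective (begin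
      fromℤ (c ℤ.^ n ℤ.* a ℤ.^ n′)
        ≡⟨ trans (fromℤ-* (c ℤ.^ n) (a ℤ.^ n′)) (cong₂ ℚ._*_ (fromℤ-^ c n) (fromℤ-^ a n′)) ⟩
      fromℤ c ℚA.^ n ℚ.* fromℤ a ℚA.^ n′
        ≡⟨ cong (λ w → w ℚA.^ n ℚ.* fromℤ a ℚA.^ n′) (sym ph≡c) ⟩
      (fromℤ (+ p) ℚ.* h) ℚA.^ n ℚ.* fromℤ a ℚA.^ n′
        ≡⟨ cong (ℚ._* (fromℤ a ℚA.^ n′)) (ℚA.^-distrib-* (fromℤ (+ p)) h n) ⟩
      fromℤ (+ p) ℚA.^ n ℚ.* h ℚA.^ n ℚ.* fromℤ a ℚA.^ n′
        ≡⟨ ℚP.*-assoc (fromℤ (+ p) ℚA.^ n) (h ℚA.^ n) (fromℤ a ℚA.^ n′) ⟩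
      fromℤ (+ p) ℚA.^ n ℚ.* (h ℚA.^ n ℚ.* fromℤ a ℚA.^ n′)
        ≡⟨ cong₂ ℚ._*_ (sym (fromℤ-^ (+ p) n)) eq ⟩
      fromℤ ((+ p) ℤ.^ n) ℚ.* fromℤ M
        ≡⟨ sym (fromℤ-* ((+ p) ℤ.^ n) M) ⟩
      fromℤ ((+ p) ℤ.^ n ℤ.* M) ∎)))
  ... | ℤDS.divides c′ c≡ = c′ , Boundedness.ν-cancel rationals p′
    (trans ph≡c (trans (cong fromℤ (trans c≡ (ℤP.*-comm c′ (+ p)))) (fromℤ-* (+ p) c′)))

  module E = Evaluation QK.const-hom QK.X

  -- `hs` is what remains after j lower coefficients were found to be integral and subtracted, which
  -- keeps the remainder bounded.
  eval-Int : ∀ j {k} (hs : Vec ℚ k) → j ℕ.+ k ≡ n → Bounded (QK.X K.^ j K.* E.eval hs) →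
    All (λ h → ℚA.Int (fromℤ (+ p) ℚ.* h)) hs → All ℚA.Int hs
  eval-Int j [] _ _ _ = []
  eval-Int j {suc k} (h ∷ hs) eq β (i ∷ is) = Int-h ∷ eval-Int (suc j) hs (trans (sym (ℕP.+-suc j k)) eq)
    (BD.tail-Bounded QK.X h QK.Int-X (Hom.hom-Int (ι-hom K) Int-h) j β) is
    where
    a-multiple : ∀ h → ℚA.Int (fromℤ (+ p) ℚ.* h) → ℚA.Int (fromℤ a ℚ.* h)
    a-multiple h (c , ph≡c) = b ℤ.* c , (begin
      fromℤ a ℚ.* h                        ≡⟨ cong (ℚ._* h) (trans (cong fromℤ (trans a≡ (ℤP.*-comm (+ p) b))) (fromℤ-* b (+ p))) ⟩
      fromℤ b ℚ.* fromℤ (+ p) ℚ.* h        ≡⟨ ℚP.*-assoc (fromℤ b) (fromℤ (+ p)) h ⟩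
      fromℤ b ℚ.* (fromℤ (+ p) ℚ.* h)      ≡⟨ trans (cong (fromℤ b ℚ.*_) ph≡c) (sym (fromℤ-* b c)) ⟩
      fromℤ (b ℤ.* c)                      ∎)
    a-multiples : ∀ {k} {hs : Vec ℚ k} → All (λ h → ℚA.Int (fromℤ (+ p) ℚ.* h)) hs → All ℚA.Int (fromℤ a QQ.• hs)
    a-multiples [] = []
    a-multiples (_∷_ {x = h} i is) = a-multiple h i ∷ a-multiples is
    Int-h : ℚA.Int h
    Int-h = leading-Int h i (ι-Bounded⁻ _ (BD.leading-Bounded n′ QK.X a h QK.X^n QK.Int-X
      (subst K.Int (E.eval-• (fromℤ a) hs) (E.Int-eval QK.Int-X (a-multiples is)))
      j k (ℕP.suc-injective (trans (sym (ℕP.+-suc j k)) eq)) β))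

  Int-of-p-multiple : ∀ g → Bounded g → K.Int (K.ι (fromℤ (+ p)) K.* g) → K.Int g
  Int-of-p-multiple g β i = eval-Int 0 g refl
    (subst Bounded (sym (trans (K.*-identityˡ (E.eval g)) (QK.eval-X g))) β)
    (AllP.map⁻ (subst (All ℚA.Int) (QK.•-one (fromℤ (+ p)) g) i))

module _ (n′ : ℕ) (a : ℤ) (sf : SquareFree a) where
  private
    n = suc n′
    K = numberField n a
    module K = Algebra K
    module B = Boundedness K

  -- A prime p common to D = D′ p and a can be cancelled from D: the element D′ f is bounded and its
  -- p-fold has integer coordinates, so `Int-of-p-multiple` applies. As D decreases, this ends with
  -- a denominator prime to a.
  coprime-denominator : ∀ f → B.Bounded f → ∀ D → D ≢ 0 → K.Int (B.ν D K.* f) → Acc _<_ D →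
    Σ ℕ λ q → Coprime q ℤ.∣ a ∣ × K.Int (B.ν q K.* f)
  coprime-denominator f β D D≢0 i (acc rec) with gcd D ℤ.∣ a ∣ ℕ.≟ 1
  ... | yes g≡1 = D , gcd≡1⇒coprime g≡1 , i
  ... | no g≢1 with prime-divisor (gcd D ℤ.∣ a ∣) (λ g≡0 → D≢0 (gcd[m,n]≡0⇒m≡0 g≡0)) g≢1
  ... | zero , pr , _ = ⊥-elim (¬prime[0] pr)
  ... | suc p′ , pr , p∣g with ∣.∣-trans p∣g (gcd[m,n]∣m D ℤ.∣ a ∣) | ℤDS.∣ᵤ⇒∣ {+ suc p′} {a} (∣.∣-trans p∣g (gcd[m,n]∣n D ℤ.∣ a ∣))
  ... | divides D′ refl | ℤDS.divides b a≡ = coprime-denominator f β D′ D′≢0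
    (Eisenstein.Int-of-p-multiple n′ a p′ pr b (trans a≡ (ℤP.*-comm b (+ suc p′))) p∤b (B.ν D′ K.* f)
      (B.Bounded-* (B.Int⇒Bounded (K.Int-ι (+ D′))) β)
      (subst K.Int (trans (cong (K._* f) (trans (cong B.ν (ℕP.*-comm D′ (suc p′))) (B.ν-* (suc p′) D′))) (K.*-assoc (B.ν (suc p′)) (B.ν D′) f)) i))
    (rec D′<D)
    where
    D′≢0 : D′ ≢ 0
    D′≢0 refl = D≢0 refl
    p≢1 : suc p′ ≢ 1
    p≢1 refl = ¬prime[1] pr
    D′<D : D′ < D′ ℕ.* suc p′
    D′<D = ℕP.m<m*n D′ (suc p′) {{ℕ.≢-nonZero D′≢0}} (ℕP.≤∧≢⇒< (s≤s z≤n) λ eq → p≢1 (sym eq))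
    p∤b : ¬ suc p′ ∣ ℤ.∣ b ∣
    p∤b p∣b = p≢1 (sf (suc p′) (subst (suc p′ ℕ.* suc p′ ∣_)
      (sym (trans (cong ℤ.∣_∣ a≡) (trans (ℤP.abs-* b (+ suc p′)) (ℕP.*-comm ℤ.∣ b ∣ (suc p′)))))
      (∣.*-monoʳ-∣ (suc p′) p∣b)))

-- From `K` to `K′` and back

Bounded-transfer : ∀ n′ a a′ → SquareFree a → a ≡ a′ [mod suc n′ ℕ.* rad (suc n′) ] →
  ∀ f → Boundedness.Bounded (numberField (suc n′) a) f → Boundedness.Bounded (numberField (suc n′) a′) f
Bounded-transfer n′ a a′ sf a≡a′ f β = combine
  (coprime-denominator n′ a sf f β (suc (proj₁ cleared)) (λ ()) (proj₂ cleared) (<-wellFounded _))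
  where
  n = suc n′
  K′ = numberField n a′
  module K′ = Algebra K′
  module B′ = Boundedness K′
  cleared = AlgebraicIntegers.numberField-Clearable n′ a f

  a′≡ : Σ ℤ λ t → a′ ≡ a ℤ.+ + n ℤ.* (+ rad n ℤ.* t)
  a′≡ with ℤDS.∣ᵤ⇒∣ {+ (n ℕ.* rad n)} {a ℤ.- a′} a≡a′
  ... | ℤDS.divides s eq = ℤ.- s , (begin
    a′                                      ≡⟨ sym (ℤP.+-identityˡ a′) ⟩
    + 0 ℤ.+ a′                              ≡⟨ cong (ℤ._+ a′) (sym (ℤP.+-inverseʳ a)) ⟩
    a ℤ.+ (ℤ.- a) ℤ.+ a′                    ≡⟨ ℤP.+-assoc a (ℤ.- a) a′ ⟩
    a ℤ.+ ((ℤ.- a) ℤ.+ a′)                  ≡⟨ cong (λ w → a ℤ.+ w) (trans (ℤP.+-comm (ℤ.- a) a′) (trans (sym (neg-sub a a′)) (cong ℤ.-_ eq))) ⟩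
    a ℤ.+ (ℤ.- (s ℤ.* + (n ℕ.* rad n)))     ≡⟨ cong (λ w → a ℤ.+ w) (trans (ℤP.neg-distribˡ-* s _) (trans (ℤP.*-comm (ℤ.- s) _)
                                                 (trans (cong (ℤ._* (ℤ.- s)) (ℤP.pos-* n (rad n))) (ℤP.*-assoc (+ n) (+ rad n) (ℤ.- s))))) ⟩
    a ℤ.+ + n ℤ.* (+ rad n ℤ.* (ℤ.- s))     ∎)
    where
    neg-sub : ∀ a b → ℤ.- (a ℤ.- b) ≡ b ℤ.- a
    neg-sub a b = trans (ℤP.neg-distrib-+ a (ℤ.- b)) (trans (ℤP.+-comm (ℤ.- a) (ℤ.- (ℤ.- b))) (cong (ℤ._- a) (ℤP.neg-involutive b)))

  a-multiple : B′.Bounded (K′.ι (fromℤ a) K′.* f)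
  a-multiple = Transfer.transfer n′ a a′ (proj₁ a′≡) (proj₂ a′≡) f β

  combine : (Σ ℕ λ q → Coprime q ℤ.∣ a ∣ × Algebra.Int (numberField n a) (Algebra._*_ (numberField n a) (Boundedness.ν (numberField n a) q) f)) → B′.Bounded f
  combine (q , q⊥a , i) = BoundedDifferences.coprime-multiples-Bounded K′ f q⊥a
    -- Whether q f has integer coordinates does not depend on which of a and a′ defines the
    -- multiplication, so this carries over from `K` to `K′`.
    (B′.Int⇒Bounded (subst (All (Algebra.Int rationals))
      (trans (QuotientProperties.•-one rationals n (fromℤ a) (a , refl) (fromℤ (+ q)) f)
        (sym (QuotientProperties.•-one rationals n (fromℤ a′) (a′ , refl) (fromℤ (+ q)) f))) i))
    (BoundedDifferences.abs-multiple-Bounded K′ a f a-multiple)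

open import Data.Nat using (_*_)

theorem1p5 : (n : ℕ) → 2 ≤ n → (a a′ : ℤ) →
    SquareFree a → SquareFree a′ → a ≡ a′ [mod n * rad n ] →
    IrreducibleXⁿ-a n a → IrreducibleXⁿ-a n a′ →
    (c : Vec ℤ n) (q : ℤ) → q ≢ + 0 →
    (IsAlgInt n a (eltOf c q) → IsAlgInt n a′ (eltOf c q)) ×
    (IsAlgInt n a′ (eltOf c q) → IsAlgInt n a (eltOf c q))
theorem1p5 (suc n′) _ a a′ sf sf′ a≡a′ _ _ c q _ =
  transfer a a′ sf a≡a′ , transfer a′ a sf′ (subst ((suc n′ * rad (suc n′)) ∣_) (ℤP.∣i-j∣≡∣j-i∣ a a′) a≡a′)
  where
  transfer : ∀ a a′ → SquareFree a → a ≡ a′ [mod suc n′ * rad (suc n′) ] →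
    IsAlgInt (suc n′) a (eltOf c q) → IsAlgInt (suc n′) a′ (eltOf c q)
  transfer a a′ sf a≡a′ i = AlgebraicIntegers.Bounded⇒IsAlgInt n′ a′ (eltOf c q)
    (Bounded-transfer n′ a a′ sf a≡a′ (eltOf c q) (AlgebraicIntegers.IsAlgInt⇒Bounded n′ a (eltOf c q) i))
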